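{- Let $H$ be a connected triangle-free graph with no full star-cutset, and let $H^*$ be a subdivision of $H$. Then $H^*$ is a restricted frame graph if and only if $H$ is either a path on at most $4$ vertices or a luxury chandelier.
   Context: A frame is the boundary of an axis-parallel box $[a,b]\times[c,d]\subset\mathbb R^2$ (with $a<b$, $c<d$); it has a left, right, top and bottom side and four corners. A graph $G$ is a restricted frame graph if there is a family $\{F_v : v\in V(G)\}$ of frames (a representation) such that for distinct $u,v$, $uv\in E(G)$ iff $F_u\cap F_v\neq\emptyset$, and: (1) no corner of a frame lies on another frame; (2) the left side of any frame does not intersect any other frame; (3) if the right side of a frame intersects a second frame, this right side intersects both the top and the bottom side of the second frame; (4) if two frames intersect, then no frame is entirely contained in the intersection of the closed regions bounded by the two frames. A full star-cutset in a connected graph $G$ is a set $N[u]=\{u\}\cup N(u)$ whose removal disconnects $G$. A chandelier is a graph obtained from a tree $T$ by adding a vertex (the pivot) adjacent to every leaf of $T$; it is a luxury chandelier if in $T$ the neighbor of each leaf has degree two. A subdivision of $H$ is obtained by replacing edges of $H$ by paths (with new internal vertices).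
   Formalization: Frames have rational coordinates and points of intersection are rational, instead of lying in the real plane; since all conditions depend only on the order of finitely many coordinates, the class of restricted frame graphs is the same. -}

module Defs where

open import Data.Nat as ℕ using (ℕ; zero; suc; _≡ᵇ_)
open import Data.Fin using (Fin; zero; suc; inject₁; fromℕ; _≟_)
open import Data.Bool using (Bool; true; false; _∧_; _∨_; not; if_then_else_)
open import Data.Bool.Properties using (∧-comm; ∨-comm)
open import Data.List using (List; map; allFin)
open import Data.Nat.ListAction using (sum)
open import Data.Product using (Σ; Σ-syntax; ∃; ∃-syntax; _×_; _,_)
open import Data.Sum using (_⊎_)
open import Data.Empty using (⊥)
open import Data.Unit using (⊤)
open import Data.Rational using (ℚ) renaming (_≤_ to _≤ℚ_; _<_ to _<ℚ_)
open import Relation.Nullary using (¬_)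
open import Relation.Nullary.Decidable using (⌊_⌋)
open import Relation.Binary.PropositionalEquality using (_≡_; _≢_; refl; cong; cong₂; trans)
open import Function.Definitions using (Injective)

record Graph (n : ℕ) : Set where
  field
    adj     : Fin n → Fin n → Bool
    adj-sym : ∀ u v → adj u v ≡ adj v u
    adj-irr : ∀ v → adj v v ≡ false
open Graph public

Adj : ∀ {n} → Graph n → Fin n → Fin n → Set
Adj G u v = adj G u v ≡ true

record _≅_ {n m : ℕ} (G : Graph n) (G' : Graph m) : Set where
  field
    to       : Fin n → Fin m
    from     : Fin m → Fin n
    to-from  : ∀ y → to (from y) ≡ y
    from-to  : ∀ x → from (to x) ≡ x
    adj-pres : ∀ u v → adj G' (to u) (to v) ≡ adj G u v

data WalkIn {n} (G : Graph n) (P : Fin n → Set) : Fin n → Fin n → Set where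
  here : ∀ {x} → P x → WalkIn G P x x
  step : ∀ {x y z} → P x → Adj G x y → WalkIn G P y z → WalkIn G P x z

Connected : ∀ {n} → Graph n → Set
Connected {n} G = (0 ℕ.< n) × (∀ x y → WalkIn G (λ _ → ⊤) x y)

TriangleFree : ∀ {n} → Graph n → Set
TriangleFree G = ∀ u v w → Adj G u v → Adj G v w → Adj G u w → ⊥

InClosedNbhd : ∀ {n} → Graph n → Fin n → Fin n → Set
InClosedNbhd G u x = (x ≡ u) ⊎ Adj G u x

IsFullStarCutset : ∀ {n} → Graph n → Fin n → Set
IsFullStarCutset G u =
  Σ[ x ∈ _ ] Σ[ y ∈ _ ]
    (¬ InClosedNbhd G u x) × (¬ InClosedNbhd G u y) ×
    ¬ WalkIn G (λ z → ¬ InClosedNbhd G u z) x y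

HasFullStarCutset : ∀ {n} → Graph n → Set
HasFullStarCutset {n} G = Σ[ u ∈ Fin n ] IsFullStarCutset G u

degree : ∀ {n} → Graph n → Fin n → ℕ
degree {n} G v = sum (map (λ u → if adj G v u then 1 else 0) (allFin n))

Cycle : ∀ {n} → Graph n → Set
Cycle {n} G = Σ[ k ∈ ℕ ] Σ[ c ∈ (Fin (suc (suc (suc k))) → Fin n) ]
  Injective _≡_ _≡_ c ×
  (∀ (i : Fin (suc (suc k))) → Adj G (c (inject₁ i)) (c (suc i))) ×
  Adj G (c (fromℕ (suc (suc k)))) (c zero)

IsTree : ∀ {n} → Graph n → Set
IsTree G = Connected G × ¬ Cycle G

pathAdj : ∀ k → Fin k → Fin k → Bool
pathAdj k i j = (suc (Data.Fin.toℕ i) ≡ᵇ Data.Fin.toℕ j) ∨ (suc (Data.Fin.toℕ j) ≡ᵇ Data.Fin.toℕ i)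

private
  suc≢ᵇ : ∀ x → (suc x ≡ᵇ x) ≡ false
  suc≢ᵇ zero = refl
  suc≢ᵇ (suc x) = suc≢ᵇ x

pathGraph : ∀ k → Graph k
adj (pathGraph k) = pathAdj k
adj-sym (pathGraph k) i j = ∨-comm (suc (Data.Fin.toℕ i) ≡ᵇ Data.Fin.toℕ j) (suc (Data.Fin.toℕ j) ≡ᵇ Data.Fin.toℕ i)
adj-irr (pathGraph k) i rewrite suc≢ᵇ (Data.Fin.toℕ i) = refl

IsSmallPath : ∀ {n} → Graph n → Set
IsSmallPath H = Σ[ k ∈ ℕ ] (1 ℕ.≤ k) × (k ℕ.≤ 4) × (pathGraph k ≅ H)

isLeafᵇ : ∀ {m} → Graph m → Fin m → Bool
isLeafᵇ T v = degree T v ≡ᵇ 1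

chandelier : ∀ {m} → Graph m → Graph (suc m)
adj (chandelier T) zero zero = false
adj (chandelier T) zero (suc j) = isLeafᵇ T j
adj (chandelier T) (suc i) zero = isLeafᵇ T i
adj (chandelier T) (suc i) (suc j) = adj T i j
adj-sym (chandelier T) zero zero = refl
adj-sym (chandelier T) zero (suc j) = refl
adj-sym (chandelier T) (suc i) zero = refl
adj-sym (chandelier T) (suc i) (suc j) = adj-sym T i j
adj-irr (chandelier T) zero = refl
adj-irr (chandelier T) (suc i) = adj-irr T i

LuxuryCondition : ∀ {m} → Graph m → Set
LuxuryCondition T = ∀ l u → degree T l ≡ 1 → Adj T l u → degree T u ≡ 2

IsLuxuryChandelier : ∀ {n} → Graph n → Set
IsLuxuryChandelier H =
  Σ[ m ∈ ℕ ] Σ[ T ∈ Graph m ] IsTree T × LuxuryCondition T × (chandelier T ≅ H)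

eqF : ∀ {n} → Fin n → Fin n → Bool
eqF i j = ⌊ i ≟ j ⌋

module _ {n} (G : Graph n) (a b : Fin n) where
  isAB : Fin n → Bool
  isAB j = eqF j a ∨ eqF j b

  isEdgeAB : Fin n → Fin n → Bool
  isEdgeAB i j = (eqF i a ∧ eqF j b) ∨ (eqF i b ∧ eqF j a)

  isEdgeAB-sym : ∀ i j → isEdgeAB i j ≡ isEdgeAB j i
  isEdgeAB-sym i j
    rewrite ∧-comm (eqF i a) (eqF j b) | ∧-comm (eqF i b) (eqF j a) =
    ∨-comm (eqF j b ∧ eqF i a) (eqF j a ∧ eqF i b)

  subdivideEdge : Graph (suc n)
  adj subdivideEdge zero zero = false
  adj subdivideEdge zero (suc j) = isAB j
  adj subdivideEdge (suc i) zero = isAB i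
  adj subdivideEdge (suc i) (suc j) = adj G i j ∧ not (isEdgeAB i j)
  adj-sym subdivideEdge zero zero = refl
  adj-sym subdivideEdge zero (suc j) = refl
  adj-sym subdivideEdge (suc i) zero = refl
  adj-sym subdivideEdge (suc i) (suc j) =
    cong₂ _∧_ (adj-sym G i j) (cong not (isEdgeAB-sym i j))
  adj-irr subdivideEdge zero = refl
  adj-irr subdivideEdge (suc i) rewrite adj-irr G i = refl

data IsSubdivision {n} (H : Graph n) : ∀ {m} → Graph m → Set where
  base : ∀ {m} {G : Graph m} → H ≅ G → IsSubdivision H G
  step : ∀ {m} {G : Graph m} {m'} {G' : Graph m'} →
         IsSubdivision H G → (a b : Fin m) → Adj G a b →
         subdivideEdge G a b ≅ G' → IsSubdivision H G'

record Frame : Set where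
  field
    xl xr yb yt : ℚ
    xl<xr : xl <ℚ xr
    yb<yt : yb <ℚ yt
open Frame public

Point : Set
Point = ℚ × ℚ

OnLeft OnRight OnTop OnBottom OnFrame InRegion IsCorner : Frame → Point → Set
OnLeft   F (x , y) = (x ≡ xl F) × (yb F ≤ℚ y) × (y ≤ℚ yt F)
OnRight  F (x , y) = (x ≡ xr F) × (yb F ≤ℚ y) × (y ≤ℚ yt F)
OnTop    F (x , y) = (y ≡ yt F) × (xl F ≤ℚ x) × (x ≤ℚ xr F)
OnBottom F (x , y) = (y ≡ yb F) × (xl F ≤ℚ x) × (x ≤ℚ xr F)
OnFrame  F p = OnLeft F p ⊎ OnRight F p ⊎ OnTop F p ⊎ OnBottom F p
InRegion F (x , y) = (xl F ≤ℚ x) × (x ≤ℚ xr F) × (yb F ≤ℚ y) × (y ≤ℚ yt F)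
IsCorner F p = (p ≡ (xl F , yb F)) ⊎ (p ≡ (xl F , yt F)) ⊎
               (p ≡ (xr F , yb F)) ⊎ (p ≡ (xr F , yt F))

Meet : (Point → Set) → (Point → Set) → Set
Meet S T = ∃[ p ] (S p × T p)

Intersect : Frame → Frame → Set
Intersect F G = Meet (OnFrame F) (OnFrame G)

module _ {n : ℕ} (Fs : Fin n → Frame) where
  Cond1 Cond2 Cond3 Cond4 : Set
  Cond1 = ∀ u v → u ≢ v → ∀ p → IsCorner (Fs u) p → ¬ OnFrame (Fs v) p
  Cond2 = ∀ u v → u ≢ v → ¬ Meet (OnLeft (Fs u)) (OnFrame (Fs v))
  Cond3 = ∀ u v → u ≢ v → Meet (OnRight (Fs u)) (OnFrame (Fs v)) →
            Meet (OnRight (Fs u)) (OnTop (Fs v)) × Meet (OnRight (Fs u)) (OnBottom (Fs v))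
  Cond4 = ∀ u v → u ≢ v → Intersect (Fs u) (Fs v) →
            ∀ w → ¬ (∀ p → OnFrame (Fs w) p → InRegion (Fs u) p × InRegion (Fs v) p)

  Represents : ∀ (G : Graph n) → Set
  Represents G = ∀ u v → u ≢ v → (Adj G u v → Intersect (Fs u) (Fs v)) × (Intersect (Fs u) (Fs v) → Adj G u v)

IsRestrictedFrameGraph : ∀ {n} → Graph n → Set
IsRestrictedFrameGraph {n} G =
  Σ[ Fs ∈ (Fin n → Frame) ] Represents Fs G × Cond1 Fs × Cond2 Fs × Cond3 Fs × Cond4 Fs

{-# OPTIONS --safe #-}
module Submission where

-- In a restricted frame graph two frames u, v intersect iff one enters the other through its right
-- side (u ⇢ v). If u ⇢ v and u′ ⇢ v in a triangle-free graph, then u and u′ are nested; call the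
-- outer one a hub. If the removal of N[p] never disconnects the graph, a hub p encloses everything
-- outside N[p], and this forces the hub to be unique. Hence every vertex of G − p is entered by at
-- most one other vertex of G − p, and G − p is a forest. The latter passes from a subdivision back
-- to H, and together with triangle-freeness, minimum degree two and the absence of full
-- star-cutsets it makes H a luxury chandelier; minimum degree at most one only leaves paths.
--
-- Conversely, a forest with a pivot p adjacent to some of its vertices of degree at most one is
-- drawn by letting each child enter its parent through a narrow slot, all inside a large frame p,
-- with the frames of the neighbours of p extended beyond the right side of p.

open import Defs
open import Relation.Nullary using (¬_)
open import Data.Sum using (_⊎_)
open import Function.Bundles using (_⇔_)

open import Data.Bool as Bool using (Bool; true; false; _∧_; not; if_then_else_)
open import Data.Bool.Properties using (¬-not)
open import Data.Empty using (⊥; ⊥-elim)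
open import Data.Fin using (Fin; zero; suc; toℕ; inject₁; fromℕ; fromℕ<; _≟_; punchIn; punchOut)
open import Data.Fin.Induction using (>-wellFounded; spo-noetherian)
open import Data.Fin.Properties
  using (any?; all?; ¬∀⟶∃¬; pigeonhole; suc-injective; punchIn-injective; punchInᵢ≢i; punchIn-punchOut;
         toℕ-injective; toℕ-inject₁; toℕ-fromℕ; toℕ-fromℕ<; toℕ<n)
open import Data.Fin.Relation.Unary.Top using (view; ‵fromℕ; ‵inject₁)
open import Data.Fin.Subset as Subset using (Subset; _∈_; _∉_; _-_; ∁; ⁅_⁆; Nonempty)
open import Data.Fin.Subset.Induction using (⊂-wellFounded)
open import Data.Fin.Subset.Properties
  using (_∈?_; nonempty?; p─q⊆p; x∈p∧x≢y⇒x∈p-y; x∈p⇒p-x⊂p; x∉p⇒x∈∁p; x∈∁p⇒x∉p; x≢y⇒x∉⁅y⁆; x∈⁅x⁆)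
open import Data.List as List using (List; []; _∷_; allFin; tabulate)
open import Data.List.Membership.Propositional renaming (_∈_ to _∈ˡ_) using ()
open import Data.List.Membership.Propositional.Properties using (∈-allFin)
open import Data.List.Relation.Unary.Any using (here; there)
open import Data.Nat as ℕ using (ℕ; zero; suc; _+_; z≤n; s≤s; _≡ᵇ_)
open import Data.Nat.ListAction using (sum)
import Data.Nat.Properties as ℕₚ
open import Data.Product using (Σ; ∃; ∃-syntax; _×_; _,_; proj₁; proj₂)
open import Data.Rational using (ℚ; 0ℚ; 1ℚ; -_) renaming (_+_ to _+ℚ_; _≤_ to _≤ℚ_; _<_ to _<ℚ_)
import Data.Rational.Properties as ℚₚ
open import Data.Sum using (inj₁; inj₂; [_,_]′)
open import Data.Unit using (⊤; tt)
open import Data.Vec.Functional as Vector using (Vector) renaming (_∷_ to _◃_)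
open import Function using (_∘_; id; flip; case_of_)
open import Function.Bundles using (mk⇔)
open import Function.Definitions using (Injective)
open import Induction.WellFounded using (Acc; acc)
import Relation.Binary.Construct.On as On
open import Relation.Binary.PropositionalEquality
  using (_≡_; _≢_; refl; sym; trans; cong; cong₂; subst; subst₂; ≢-sym)
open import Relation.Binary.Structures using (IsStrictPartialOrder)
open import Relation.Nullary using (Dec; yes; no; contradiction)
open import Relation.Nullary.Decidable using (_×-dec_; _⊎-dec_; _→-dec_; ¬?; decidable-stable)
open import Relation.Unary using (Decidable)

-- Walks, cores and isomorphisms

-- The hypotheses on H and the information gained from its subdivision travel in opposite
-- directions. Upwards, connectedness outside every closed neighbourhood survives subdivision only
-- in the presence of minimum degree two: subdividing the path on four vertices gives the path on
-- five vertices, whose middle vertex yields a full star-cutset. This is why graphs with a vertex of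
-- degree at most one are split off at the start. Downwards, only the vertex whose removal leaves a
-- forest is carried back; the chandelier is then read off in H itself, so that no subdivided tree
-- has to be contracted. Forests are expressed through vertex sets of minimum degree two rather than
-- cycles, because such a set passes through the subdivision of one edge in either direction without
-- any order along a cycle. For the converse, `Pivot` asks neither for connectedness nor for every
-- leaf to be joined to p. Hence an end of a path qualifies just as the pivot of a luxury chandelier
-- does, and each subdivision step preserves the notion.

module _ {n} (G : Graph n) where
  Adj? : ∀ u v → Dec (Adj G u v)
  Adj? u v = adj G u v Bool.≟ true

  Adj-sym : ∀ {u v} → Adj G u v → Adj G v u
  Adj-sym {u} {v} = trans (adj-sym G v u)

  Adj⇒≢ : ∀ {u v} → Adj G u v → u ≢ v
  Adj⇒≢ {u} uv refl with () ← trans (sym uv) (adj-irr G u)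

  InClosedNbhd? : ∀ u x → Dec (InClosedNbhd G u x)
  InClosedNbhd? u x = (x ≟ u) ⊎-dec Adj? u x

bool-ext : ∀ {b c} → (b ≡ true → c ≡ true) → (c ≡ true → b ≡ true) → b ≡ c
bool-ext {true}          to _    = sym (to refl)
bool-ext {false} {false} _  _    = refl
bool-ext {false} {true}  _  from = from refl

module _ {n} {G : Graph n} {P : Fin n → Set} where
  walk-source : ∀ {x y} → WalkIn G P x y → P x
  walk-source (here px) = px
  walk-source (step px _ _) = px

  walk-++ : ∀ {x y z} → WalkIn G P x y → WalkIn G P y z → WalkIn G P x z
  walk-++ (here _) w = w
  walk-++ (step px xy v) w = step px xy (walk-++ v w)

  walk-reverse : ∀ {x y} → WalkIn G P x y → WalkIn G P y x
  walk-reverse (here px) = here px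
  walk-reverse (step px xy w) =
    walk-++ (walk-reverse w) (step (walk-source w) (Adj-sym G xy) (here px))

  walk-map : ∀ {m} {H : Graph m} {Q} (f : Fin n → Fin m) →
             (∀ {x} → P x → Q (f x)) → (∀ {x y} → P x → P y → Adj G x y → Adj H (f x) (f y)) →
             ∀ {x y} → WalkIn G P x y → WalkIn H Q (f x) (f y)
  walk-map f p a (here px) = here (p px)
  walk-map f p a (step px xy w) = step (p px) (a px (walk-source w) xy) (walk-map f p a w)

-- Reachability is decided as in the Floyd–Warshall algorithm: Via ks x y allows only the
-- intermediate vertices in ks.
module _ {n} (G : Graph n) (P : Fin n → Set) where
  Via : List (Fin n) → Fin n → Fin n → Set
  Via []       x y = x ≡ y ⊎ Adj G x y
  Via (k ∷ ks) x y = Via ks x y ⊎ (Via ks x k × P k × Via ks k y)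

  Via? : Decidable P → ∀ ks x y → Dec (Via ks x y)
  Via? P? []       x y = (x ≟ y) ⊎-dec Adj? G x y
  Via? P? (k ∷ ks) x y = Via? P? ks x y ⊎-dec (Via? P? ks x k ×-dec (P? k ×-dec Via? P? ks k y))

  Via⇒walk : ∀ ks {x y} → P x → P y → Via ks x y → WalkIn G P x y
  Via⇒walk [] px py (inj₁ refl) = here px
  Via⇒walk [] px py (inj₂ xy)   = step px xy (here py)
  Via⇒walk (k ∷ ks) px py (inj₁ v) = Via⇒walk ks px py v
  Via⇒walk (k ∷ ks) px py (inj₂ (v , pk , w)) = walk-++ (Via⇒walk ks px pk v) (Via⇒walk ks pk py w)

  Via-base : ∀ ks {x y} → Via [] x y → Via ks x y
  Via-base []       v = v
  Via-base (k ∷ ks) v = inj₁ (Via-base ks v)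

  Via-trans : ∀ {ks x y z} → z ∈ˡ ks → P z → Via ks x z → Via ks z y → Via ks x y
  Via-trans (here refl) pz v w = inj₂ (first v , pz , last w)
    where
    first : ∀ {ks x z} → Via (z ∷ ks) x z → Via ks x z
    first (inj₁ v) = v
    first (inj₂ (v , _)) = v
    last : ∀ {ks z y} → Via (z ∷ ks) z y → Via ks z y
    last (inj₁ w) = w
    last (inj₂ (_ , _ , w)) = w
  Via-trans (there i) pz (inj₁ v) (inj₁ w) = inj₁ (Via-trans i pz v w)
  Via-trans (there i) pz (inj₁ v) (inj₂ (w , pk , w′)) = inj₂ (Via-trans i pz v w , pk , w′)
  Via-trans (there i) pz (inj₂ (v , pk , v′)) (inj₁ w) = inj₂ (v , pk , Via-trans i pz v′ w)
  -- Both pieces pass through k, so the stretch between the two visits, z included, is cut out.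
  Via-trans (there i) pz (inj₂ (v , pk , _)) (inj₂ (_ , _ , w)) = inj₂ (v , pk , w)

  walk⇒Via : ∀ {x y} → WalkIn G P x y → Via (allFin n) x y
  walk⇒Via (here _) = Via-base (allFin n) (inj₁ refl)
  walk⇒Via (step {y = y} _ xy w) =
    Via-trans (∈-allFin y) (walk-source w) (Via-base (allFin n) (inj₂ xy)) (walk⇒Via w)

  -- The absence of a full star-cutset yields walks only under a double negation; decidability of
  -- reachability removes it.
  walk-stable : Decidable P → ∀ {x y} → P x → P y → ¬ ¬ WalkIn G P x y → WalkIn G P x y
  walk-stable P? px py ¬¬w with Via? P? (allFin n) _ _
  ... | yes v = Via⇒walk (allFin n) px py v
  ... | no ¬v = contradiction (¬v ∘ walk⇒Via) ¬¬w

-- Since a core always lets one leave a vertex avoiding a given y, it is a subgraph of minimum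
-- degree two; a graph is a forest iff it has no nonempty core.
Core : ∀ {n} → Graph n → (Fin n → Set) → Set
Core G S = ∀ x y → S x → ∃[ z ] S z × Adj G x z × z ≢ y

ForestWithout : ∀ {n} → Graph n → Fin n → Set₁
ForestWithout {n} G p = ∀ (S : Fin n → Set) → ¬ S p → Core G S → ∀ x → ¬ S x

record Robust {n} (G : Graph n) : Set where
  field
    triangleFree : TriangleFree G
    minDegree    : Core G (λ _ → ⊤)
    connect      : ∀ u {x y} → ¬ InClosedNbhd G u x → ¬ InClosedNbhd G u y →
                   WalkIn G (λ z → ¬ InClosedNbhd G u z) x y

  branch : ∀ x y → ∃[ z ] Adj G x z × z ≢ y
  branch x y = let z , _ , xz , z≢y = minDegree x y tt in z , xz , z≢y

  escape : ∀ {u x} → Adj G u x → ∃[ y ] Adj G x y × ¬ InClosedNbhd G u y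
  escape {u} {x} ux = let y , xy , y≢u = branch x u in
    y , xy , λ { (inj₁ y≡u) → y≢u y≡u ; (inj₂ uy) → triangleFree u x y ux xy uy }

noFullStarCutset⇒connect : ∀ {n} (G : Graph n) → ¬ HasFullStarCutset G →
  ∀ u {x y} → ¬ InClosedNbhd G u x → ¬ InClosedNbhd G u y →
  WalkIn G (λ z → ¬ InClosedNbhd G u z) x y
noFullStarCutset⇒connect G noFSC u x∉ y∉ =
  walk-stable G _ (λ z → ¬? (InClosedNbhd? G u z)) x∉ y∉ λ ¬w → noFSC (u , _ , _ , x∉ , y∉ , ¬w)

module _ {n m} {G : Graph n} {H : Graph m} where
  ≅-sym : G ≅ H → H ≅ G
  ≅-sym i = record
    { to = from ; from = to ; to-from = from-to ; from-to = to-from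
    ; adj-pres = λ u v → trans (sym (adj-pres (from u) (from v))) (cong₂ (adj H) (to-from u) (to-from v)) }
    where open _≅_ i

  module _ (i : G ≅ H) where
    open _≅_ i

    to-Adj : ∀ {u v} → Adj G u v → Adj H (to u) (to v)
    to-Adj {u} {v} = trans (adj-pres u v)

    from-Adj : ∀ {u v} → Adj H u v → Adj G (from u) (from v)
    from-Adj {u} {v} uv = trans (_≅_.adj-pres (≅-sym i) u v) uv

    from-to-Adj : ∀ {u v} → Adj H (to u) v → Adj G u (from v)
    from-to-Adj {u} {v} a = subst (λ x → Adj G x (from v)) (from-to u) (from-Adj a)

    to-from-Adj : ∀ {u v} → Adj G (from u) v → Adj H u (to v)
    to-from-Adj {u} {v} a = subst (λ x → Adj H x (to v)) (to-from u) (to-Adj a)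

    from-injective : ∀ {x y} → from x ≡ from y → x ≡ y
    from-injective e = trans (sym (to-from _)) (trans (cong to e) (to-from _))

    to-∈N : ∀ {u x} → InClosedNbhd H u x → InClosedNbhd G (from u) (from x)
    to-∈N (inj₁ e) = inj₁ (cong from e)
    to-∈N (inj₂ a) = inj₂ (from-Adj a)

    from-∈N : ∀ {u x} → InClosedNbhd G (from u) x → InClosedNbhd H u (to x)
    from-∈N (inj₁ refl) = inj₁ (to-from _)
    from-∈N (inj₂ a) = inj₂ (to-from-Adj a)

    Robust-≅ : Robust G → Robust H
    Robust-≅ R = record
      { triangleFree = λ u v w uv vw uw → triangleFree _ _ _ (from-Adj uv) (from-Adj vw) (from-Adj uw)
      ; minDegree = λ x y _ → let z , _ , a , z≢y = minDegree (from x) (from y) tt in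
          to z , tt , to-from-Adj a , λ e → z≢y (trans (sym (from-to z)) (cong from e))
      ; connect = λ u {x} {y} x∉ y∉ → subst₂ (WalkIn H _) (to-from x) (to-from y)
          (walk-map to (λ z∉ z∈ → z∉ (subst (InClosedNbhd G (from u)) (from-to _) (to-∈N z∈)))
                    (λ _ _ → to-Adj)
             (connect (from u) (λ e → x∉ (subst (InClosedNbhd H u) (to-from x) (from-∈N e)))
                               (λ e → y∉ (subst (InClosedNbhd H u) (to-from y) (from-∈N e)))))
      }
      where open Robust R

    ForestWithout-≅ : ∀ {p} → ForestWithout G p → ForestWithout H (to p)
    ForestWithout-≅ {p} F S ¬Sp core x Sx =
      F (S ∘ to) ¬Sp core′ (from x) (subst S (sym (to-from x)) Sx)
      where
      core′ : Core G (S ∘ to)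
      core′ x y Sx = let z , Sz , a , z≢y = core (to x) (to y) Sx in
        from z , subst S (sym (to-from z)) Sz , from-to-Adj a ,
        λ e → z≢y (trans (sym (to-from z)) (cong to e))

-- Subdivision

module Subdivide {n} (G : Graph n) {a b : Fin n} (ab : Adj G a b) where
  G′ : Graph _
  G′ = subdivideEdge G a b

  Edge : Fin n → Fin n → Set
  Edge i j = (i ≡ a × j ≡ b) ⊎ (i ≡ b × j ≡ a)

  a≢b : a ≢ b
  a≢b = Adj⇒≢ G ab

  private
    Edge? : ∀ i j → Dec (Edge i j)
    Edge? i j = ((i ≟ a) ×-dec (j ≟ b)) ⊎-dec ((i ≟ b) ×-dec (j ≟ a))

    Edge⇒true : ∀ i j → Edge i j → isEdgeAB G a b i j ≡ true
    Edge⇒true i j e with i ≟ a | j ≟ b | i ≟ b | j ≟ a | e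
    ... | yes _ | yes _ | _ | _ | _ = refl
    ... | yes _ | no ¬q | yes _ | yes _ | _ = refl
    ... | no _  | _ | yes _ | yes _ | _ = refl
    ... | yes _ | no ¬q | _ | _ | inj₁ (_ , q) = contradiction q ¬q
    ... | no ¬p | _ | _ | _ | inj₁ (p , _) = contradiction p ¬p
    ... | _ | _ | no ¬p | _ | inj₂ (p , _) = contradiction p ¬p
    ... | _ | _ | _ | no ¬q | inj₂ (_ , q) = contradiction q ¬q

    true⇒Edge : ∀ i j → isEdgeAB G a b i j ≡ true → Edge i j
    true⇒Edge i j e with i ≟ a | j ≟ b | i ≟ b | j ≟ a
    ... | yes p | yes q | _ | _ = inj₁ (p , q)
    ... | _ | _ | yes p | yes q = inj₂ (p , q)
    true⇒Edge i j () | yes _ | no _ | yes _ | no _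
    true⇒Edge i j () | yes _ | no _ | no _ | _
    true⇒Edge i j () | no _ | _ | yes _ | no _
    true⇒Edge i j () | no _ | _ | no _ | _

  mid⇒end : ∀ j → Adj G′ zero (suc j) → j ≡ a ⊎ j ≡ b
  mid⇒end j e with j ≟ a | j ≟ b
  ... | yes p | _ = inj₁ p
  ... | no _ | yes q = inj₂ q
  mid⇒end j () | no _ | no _

  end⇒mid : ∀ {j} → j ≡ a ⊎ j ≡ b → Adj G′ zero (suc j)
  end⇒mid {j} e with j ≟ a | j ≟ b
  ... | yes p | _ = refl
  ... | no _ | yes q = refl
  ... | no ¬p | no ¬q = contradiction e [ ¬p , ¬q ]′

  old⇒Adj : ∀ {i j} → Adj G′ (suc i) (suc j) → Adj G i j × ¬ Edge i j
  old⇒Adj {i} {j} e with adj G i j | isEdgeAB G a b i j in eq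
  ... | true | false = refl , λ ed → case trans (sym eq) (Edge⇒true i j ed) of λ ()

  Adj⇒old : ∀ {i j} → Adj G i j → ¬ Edge i j → Adj G′ (suc i) (suc j)
  Adj⇒old {i} {j} e ¬ed with adj G i j | isEdgeAB G a b i j in eq
  ... | true | false = refl
  ... | true | true = contradiction (true⇒Edge i j eq) ¬ed

  lift-Adj : ∀ {i j} → Adj G i j → Adj G′ (suc i) (suc j) ⊎ (Adj G′ (suc i) zero × Edge i j)
  lift-Adj {i} {j} ij with Edge? i j
  ... | no ¬e = inj₁ (Adj⇒old ij ¬e)
  ... | yes (inj₁ (refl , refl)) = inj₂ (end⇒mid (inj₁ refl) , inj₁ (refl , refl))
  ... | yes (inj₂ (refl , refl)) = inj₂ (end⇒mid (inj₂ refl) , inj₂ (refl , refl))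

  end-unique : ∀ {x y z} → Edge x y → Edge x z → y ≡ z
  end-unique (inj₁ (refl , refl)) (inj₁ (_ , refl)) = refl
  end-unique (inj₁ (refl , refl)) (inj₂ (e , _)) = contradiction e a≢b
  end-unique (inj₂ (refl , refl)) (inj₁ (e , _)) = contradiction (sym e) a≢b
  end-unique (inj₂ (refl , refl)) (inj₂ (_ , refl)) = refl

  -- The new vertex joins exactly when both ends of its edge do: it then has its two neighbours, and
  -- each end finds it in place of the other end.
  Lifted : (Fin n → Set) → Fin (ℕ.suc n) → Set
  Lifted S zero    = S a × S b
  Lifted S (suc i) = S i

  core-lift : ∀ {S} → Core G S → Core G′ (Lifted S)
  core-lift core zero y (Sa , Sb) with y ≟ suc a
  ... | yes refl = suc b , Sb , end⇒mid (inj₂ refl) , λ e → a≢b (sym (suc-injective e))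
  ... | no ¬y = suc a , Sa , end⇒mid (inj₁ refl) , λ e → ¬y (sym e)
  core-lift {S} core (suc i) (suc y) Si with core i y Si
  ... | z , Sz , iz , z≢y with lift-Adj iz
  ... | inj₁ iz′ = suc z , Sz , iz′ , z≢y ∘ suc-injective
  ... | inj₂ (is , inj₁ (refl , refl)) = zero , (Si , Sz) , is , λ ()
  ... | inj₂ (is , inj₂ (refl , refl)) = zero , (Sz , Si) , is , λ ()
  core-lift {S} core (suc i) zero Si = k
    where
    other : ∀ y → (∀ {z} → Edge i z → z ≡ y) → ∃[ z ] Lifted S z × Adj G′ (suc i) z × z ≢ zero
    other y h = let z , Sz , iz , z≢y = core i y Si in
      suc z , Sz , Adj⇒old iz (λ e → z≢y (h e)) , λ ()
    k : ∃[ z ] Lifted S z × Adj G′ (suc i) z × z ≢ zero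
    k with i ≟ a | i ≟ b
    ... | yes refl | _ = other b λ e → end-unique e (inj₁ (refl , refl))
    ... | no _ | yes refl = other a λ e → end-unique e (inj₂ (refl , refl))
    -- Away from the subdivided edge nothing has to be avoided in G, so i is an arbitrary choice.
    ... | no ¬a | no ¬b = other i λ { (inj₁ (e , _)) → contradiction e ¬a ; (inj₂ (e , _)) → contradiction e ¬b }

  -- If the new vertex is in the core, so are both of its neighbours; hence a step onto it can be
  -- replaced by a step along the old edge.
  core-lower : ∀ {S} → Core G′ S → Core G (S ∘ suc)
  core-lower {S} core x y Sx with core (suc x) (suc y) Sx
  ... | suc z , Sz , xz , z≢y = z , Sz , proj₁ (old⇒Adj xz) , z≢y ∘ cong suc
  ... | zero , Sz , xz , _ = k (mid⇒end x xz)
    where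
    ends : ∀ {e} → S zero → e ≡ a ⊎ e ≡ b → ∃[ e′ ] S (suc e′) × Edge e e′
    ends S0 (inj₁ refl) with core zero (suc a) S0
    ... | zero , _ , e , _ = contradiction refl (Adj⇒≢ G′ {zero} e)
    ... | suc z , Sz , e , ne with mid⇒end z e
    ... | inj₁ refl = contradiction refl ne
    ... | inj₂ refl = b , Sz , inj₁ (refl , refl)
    ends S0 (inj₂ refl) with core zero (suc b) S0
    ... | zero , _ , e , _ = contradiction refl (Adj⇒≢ G′ {zero} e)
    ... | suc z , Sz , e , ne with mid⇒end z e
    ... | inj₂ refl = contradiction refl ne
    ... | inj₁ refl = a , Sz , inj₂ (refl , refl)

    edge⇒Adj : ∀ {i j} → Edge i j → Adj G i j
    edge⇒Adj (inj₁ (refl , refl)) = ab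
    edge⇒Adj (inj₂ (refl , refl)) = Adj-sym G ab

    k : x ≡ a ⊎ x ≡ b → ∃[ z ] S (suc z) × Adj G x z × z ≢ y
    k end with ends Sz end
    ... | e′ , Se′ , xe′ with e′ ≟ y
    ... | no e′≢y = e′ , Se′ , edge⇒Adj xe′ , e′≢y
    -- The far end is the vertex to be avoided. A neighbour of x other than the new vertex is
    -- reached by an edge that was not subdivided, and therefore differs from that end.
    ... | yes refl with core (suc x) zero Sx
    ... | zero , _ , _ , ne = contradiction refl ne
    ... | suc w , Sw , xw , _ = let xw′ , ¬e = old⇒Adj xw in
      w , Sw , xw′ , λ { refl → ¬e xe′ }

  forest-lift : ∀ {p} → ForestWithout G p → ForestWithout G′ (suc p)
  forest-lift F S ¬Sp core = nowhere
    where
    old : ∀ i → ¬ S (suc i)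
    old = F (S ∘ suc) ¬Sp (core-lower core)
    nowhere : ∀ x → ¬ S x
    nowhere (suc i) = old i
    nowhere zero S0 with core zero zero S0
    ... | zero , _ , _ , ne = ne refl
    ... | suc z , Sz , _ = old z Sz

  forest-lower : ∀ p → ForestWithout G′ p → ∃ (ForestWithout G)
  forest-lower (suc p) F = p , λ S ¬Sp core x Sx → F (Lifted S) ¬Sp (core-lift core) (suc x) Sx
  -- For a removed subdivision vertex either end of its edge will do: a set that misses a has a lift
  -- that misses the subdivision vertex.
  forest-lower zero F = a , λ S ¬Sa core x Sx →
    F (Lifted S) (¬Sa ∘ proj₁) (core-lift core) (suc x) Sx

  walk-lift : ∀ {P P′} → (∀ {i} → P i → P′ (suc i)) → (P a → P b → P′ zero) →
              ∀ {x y} → WalkIn G P x y → WalkIn G′ P′ (suc x) (suc y)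
  walk-lift old mid (here px) = here (old px)
  walk-lift old mid (step px xy w) with lift-Adj xy
  ... | inj₁ xy′ = step (old px) xy′ (walk-lift old mid w)
  ... | inj₂ (xs , inj₁ (refl , refl)) =
    step (old px) xs (step (mid px (walk-source w)) (end⇒mid (inj₂ refl)) (walk-lift old mid w))
  ... | inj₂ (xs , inj₂ (refl , refl)) =
    step (old px) xs (step (mid (walk-source w) px) (end⇒mid (inj₁ refl)) (walk-lift old mid w))

  -- Removing N[u] from G′ leaves the graph G − N[c], up to subdivision and additional vertices;
  -- here c = a when u is the new vertex. Each additional vertex has a neighbour outside N[c].
  module _ (R : Robust G) where
    open Robust R

    private
      out : ∀ {k} (H : Graph k) → Fin k → Fin k → Set
      out H u x = ¬ InClosedNbhd H u x

      connect-via : ∀ {c u} → (∀ {i} → out G c i → out G′ u (suc i)) →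
        (out G c a → out G c b → out G′ u zero) →
        (∀ x → out G′ u x → ∃[ i ] out G c i × WalkIn G′ (out G′ u) x (suc i)) →
        ∀ {x y} → out G′ u x → out G′ u y → WalkIn G′ (out G′ u) x y
      connect-via {c} old mid reach {x} {y} x∉ y∉ = let i , i∉ , v = reach x x∉ ; j , j∉ , w = reach y y∉ in
        walk-++ v (walk-++ (walk-lift old mid (connect c i∉ j∉)) (walk-reverse w))

      connect-mid : ∀ {x y} → out G′ zero x → out G′ zero y → WalkIn G′ (out G′ zero) x y
      connect-mid = connect-via old (λ a∉ _ → contradiction (inj₁ refl) a∉) reach
        where
        ends : ∀ {i} → i ≢ a → i ≢ b → out G′ zero (suc i)
        ends _ _ (inj₁ ())
        ends {i} i≢a i≢b (inj₂ e) = [ i≢a , i≢b ]′ (mid⇒end i e)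
        old : ∀ {i} → out G a i → out G′ zero (suc i)
        old i∉ = ends (i∉ ∘ inj₁) λ { refl → i∉ (inj₂ ab) }
        reach : ∀ x → out G′ zero x → ∃[ i ] out G a i × WalkIn G′ (out G′ zero) x (suc i)
        reach zero x∉ = contradiction (inj₁ refl) x∉
        reach (suc i) x∉ with InClosedNbhd? G a i
        ... | no i∉ = i , i∉ , here x∉
        ... | yes (inj₁ refl) = contradiction (inj₂ (end⇒mid (inj₁ refl))) x∉
        ... | yes (inj₂ ai) with escape ai
        ... | j , ij , j∉ = j , j∉ , step x∉ (Adj⇒old ij ¬e) (here (old j∉))
          where
          ¬e : ¬ Edge i j
          ¬e (inj₁ (refl , _)) = Adj⇒≢ G ai refl
          ¬e (inj₂ (_ , refl)) = j∉ (inj₁ refl)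

      connect-old : ∀ c {x y} → out G′ (suc c) x → out G′ (suc c) y → WalkIn G′ (out G′ (suc c)) x y
      connect-old c = connect-via old mid reach
        where
        old : ∀ {i} → out G c i → out G′ (suc c) (suc i)
        old i∉ (inj₁ e) = i∉ (inj₁ (suc-injective e))
        old i∉ (inj₂ e) = i∉ (inj₂ (proj₁ (old⇒Adj e)))
        mid : out G c a → out G c b → out G′ (suc c) zero
        mid a∉ b∉ (inj₂ e) with mid⇒end c e
        ... | inj₁ refl = a∉ (inj₁ refl)
        ... | inj₂ refl = b∉ (inj₁ refl)
        reach : ∀ x → out G′ (suc c) x → ∃[ i ] out G c i × WalkIn G′ (out G′ (suc c)) x (suc i)
        reach zero x∉ with InClosedNbhd? G c a | InClosedNbhd? G c b
        ... | no a∉ | _ = a , a∉ , step x∉ (end⇒mid (inj₁ refl)) (here (old a∉))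
        ... | yes _ | no b∉ = b , b∉ , step x∉ (end⇒mid (inj₂ refl)) (here (old b∉))
        ... | yes (inj₁ refl) | yes _ = contradiction (inj₂ (end⇒mid (inj₁ refl))) x∉
        ... | yes (inj₂ _) | yes (inj₁ refl) = contradiction (inj₂ (end⇒mid (inj₂ refl))) x∉
        ... | yes (inj₂ ca) | yes (inj₂ cb) = ⊥-elim (triangleFree c a b ca ab cb)
        reach (suc i) x∉ with InClosedNbhd? G c i
        ... | no i∉ = i , i∉ , here x∉
        ... | yes (inj₁ refl) = contradiction (inj₁ refl) x∉
        ... | yes (inj₂ ci) with lift-Adj ci
        ... | inj₁ ci′ = contradiction (inj₂ ci′) x∉
        -- A neighbour i of c has left the closed neighbourhood only if ci is the subdivided edge; a
        -- further neighbour of i then lies outside N[c].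
        ... | inj₂ (_ , e) with escape ci
        ... | j , ij , j∉ = j , j∉ , step x∉ (Adj⇒old ij ¬e) (here (old j∉))
          where
          Edge-sym : ∀ {i j} → Edge i j → Edge j i
          Edge-sym (inj₁ (p , q)) = inj₂ (q , p)
          Edge-sym (inj₂ (p , q)) = inj₁ (q , p)
          ¬e : ¬ Edge i j
          ¬e e′ = j∉ (inj₁ (end-unique e′ (Edge-sym e)))

    robust-lift : Robust G′
    robust-lift = record { triangleFree = tri ; minDegree = deg ; connect = con }
      where
      deg : Core G′ (λ _ → ⊤)
      deg zero y _ = let z , _ , e = core-lift minDegree zero y (tt , tt) in z , tt , e
      deg (suc x) y _ = let z , _ , e = core-lift minDegree (suc x) y tt in z , tt , e
      con : ∀ u {x y} → out G′ u x → out G′ u y → WalkIn G′ (out G′ u) x y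
      con zero = connect-mid
      con (suc c) = connect-old c
      no-mid : ∀ {i j} → Adj G′ zero (suc i) → Adj G′ zero (suc j) → ¬ Adj G′ (suc i) (suc j)
      no-mid {i} {j} p q r with mid⇒end i p | mid⇒end j q | old⇒Adj r
      ... | inj₁ refl | inj₁ refl | e , _ = Adj⇒≢ G e refl
      ... | inj₂ refl | inj₂ refl | e , _ = Adj⇒≢ G e refl
      ... | inj₁ refl | inj₂ refl | _ , ¬e = ¬e (inj₁ (refl , refl))
      ... | inj₂ refl | inj₁ refl | _ , ¬e = ¬e (inj₂ (refl , refl))
      tri : TriangleFree G′
      tri (suc u) (suc v) (suc w) p q r =
        triangleFree u v w (proj₁ (old⇒Adj p)) (proj₁ (old⇒Adj q)) (proj₁ (old⇒Adj r))
      tri zero (suc v) (suc w) p q r = no-mid p r q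
      tri (suc u) zero (suc w) p q r = no-mid p q r
      tri (suc u) (suc v) zero p q r = no-mid r q p
      tri zero zero _ p _ _ = Adj⇒≢ G′ {zero} p refl
      tri (suc u) zero zero _ q _ = Adj⇒≢ G′ {zero} q refl
      tri zero (suc v) zero _ _ r = Adj⇒≢ G′ {zero} r refl

-- Common generalisation of luxury chandeliers and paths, closed under subdivision.
record Pivot {n} (G : Graph n) (p : Fin n) : Set₁ where
  field
    forest      : ForestWithout G p
    independent : ∀ k l → Adj G p k → Adj G p l → ¬ Adj G k l
    pendant     : ∀ l y z → Adj G p l → y ≢ p → z ≢ p → Adj G l y → Adj G l z → y ≡ z

Pivot-≅ : ∀ {n m} {G : Graph n} {H : Graph m} {p} (i : G ≅ H) → Pivot G p → Pivot H (_≅_.to i p)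
Pivot-≅ {H = H} {p} i P = record
  { forest = ForestWithout-≅ i forest
  ; independent = λ _ _ a b c → independent _ _ (from-to-Adj i a) (from-to-Adj i b) (from-Adj i c)
  ; pendant = λ _ _ _ a y≢p z≢p ly lz → from-injective i
      (pendant _ _ _ (from-to-Adj i a) (y≢p ∘ back) (z≢p ∘ back) (from-Adj i ly) (from-Adj i lz)) }
  where
  open Pivot P
  open _≅_ i
  back : ∀ {y} → from y ≡ p → y ≡ to p
  back refl = sym (to-from _)

module _ {n} (G : Graph n) {a b : Fin n} (ab : Adj G a b) where
  open Subdivide G ab

  Pivot-lift : ∀ {p} → Pivot G p → Pivot G′ (suc p)
  Pivot-lift {p} P = record { forest = forest-lift forest ; independent = ind ; pendant = pend }
    where
    open Pivot P
    ind : ∀ k l → Adj G′ (suc p) k → Adj G′ (suc p) l → ¬ Adj G′ k l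
    ind zero zero _ _ r = Adj⇒≢ G′ {zero} r refl
    ind (suc k) (suc l) x y r = independent k l (proj₁ (old⇒Adj x)) (proj₁ (old⇒Adj y)) (proj₁ (old⇒Adj r))
    ind zero (suc l) x y r with mid⇒end p x | mid⇒end l r
    ... | inj₁ refl | inj₁ refl = Adj⇒≢ G′ {suc l} y refl
    ... | inj₁ refl | inj₂ refl = proj₂ (old⇒Adj y) (inj₁ (refl , refl))
    ... | inj₂ refl | inj₁ refl = proj₂ (old⇒Adj y) (inj₂ (refl , refl))
    ... | inj₂ refl | inj₂ refl = Adj⇒≢ G′ {suc l} y refl
    ind (suc k) zero x y r = ind zero (suc k) y x r

    pend : ∀ l y z → Adj G′ (suc p) l → y ≢ suc p → z ≢ suc p → Adj G′ l y → Adj G′ l z → y ≡ z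
    pend zero zero z _ _ _ ly _ = contradiction refl (Adj⇒≢ G′ {zero} ly)
    pend zero (suc y) zero _ _ _ _ lz = contradiction refl (Adj⇒≢ G′ {zero} lz)
    pend zero (suc y) (suc z) pl y≢p z≢p ly lz with mid⇒end p pl | mid⇒end y ly | mid⇒end z lz
    ... | inj₁ refl | inj₁ refl | _ = contradiction refl y≢p
    ... | inj₁ refl | _ | inj₁ refl = contradiction refl z≢p
    ... | inj₁ refl | inj₂ refl | inj₂ refl = refl
    ... | inj₂ refl | inj₂ refl | _ = contradiction refl y≢p
    ... | inj₂ refl | _ | inj₂ refl = contradiction refl z≢p
    ... | inj₂ refl | inj₁ refl | inj₁ refl = refl
    pend (suc l) zero zero _ _ _ _ _ = refl
    pend (suc l) (suc y) (suc z) pl y≢p z≢p ly lz =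
      cong suc (pendant l y z (proj₁ (old⇒Adj pl)) (y≢p ∘ cong suc) (z≢p ∘ cong suc) (proj₁ (old⇒Adj ly)) (proj₁ (old⇒Adj lz)))
    pend (suc l) zero (suc z) pl y≢p z≢p ly lz = ⊥-elim (mixed pl z≢p ly lz)
      where
      -- If l is an end of the subdivided edge, `pendant` makes this edge the only one from l in G -
      -- p. The other end is not p because the edge from p to l is still present.
      mixed : ∀ {l z} → Adj G′ (suc p) (suc l) → suc z ≢ suc p → Adj G′ (suc l) zero → Adj G′ (suc l) (suc z) → ⊥
      mixed {l} {z} pl z≢p ly lz with old⇒Adj pl | old⇒Adj lz | mid⇒end l ly
      ... | pl′ , ¬e | lz′ , ¬e′ | inj₁ refl = ¬e′ (inj₁ (refl , pendant _ _ _ pl′ (z≢p ∘ cong suc) (λ { refl → ¬e (inj₂ (refl , refl)) }) lz′ ab))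
      ... | pl′ , ¬e | lz′ , ¬e′ | inj₂ refl = ¬e′ (inj₂ (refl , pendant _ _ _ pl′ (z≢p ∘ cong suc) (λ { refl → ¬e (inj₁ (refl , refl)) }) lz′ (Adj-sym G ab)))
    pend (suc l) (suc y) zero pl y≢p z≢p ly lz = sym (pend (suc l) zero (suc y) pl z≢p y≢p lz ly)

subdivision-Robust : ∀ {n m} {H : Graph n} {G : Graph m} → IsSubdivision H G → Robust H → Robust G
subdivision-Robust (base i) R = Robust-≅ i R
subdivision-Robust (step {G = G} s a b ab i) R =
  Robust-≅ i (Subdivide.robust-lift G ab (subdivision-Robust s R))

subdivision-Pivot : ∀ {n m} {H : Graph n} {G : Graph m} → IsSubdivision H G → ∃ (Pivot H) → ∃ (Pivot G)
subdivision-Pivot (base i) (p , P) = _ , Pivot-≅ i P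
subdivision-Pivot (step {G = G} s a b ab i) P =
  let q , Q = subdivision-Pivot s P in _ , Pivot-≅ i (Pivot-lift G ab Q)

subdivision-forest : ∀ {n m} {H : Graph n} {G : Graph m} → IsSubdivision H G →
                     ∃ (ForestWithout G) → ∃ (ForestWithout H)
subdivision-forest (base i) (p , F) = _ , ForestWithout-≅ (≅-sym i) F
subdivision-forest (step {G = G} s a b ab i) (p , F) =
  subdivision-forest s (Subdivide.forest-lower G ab _ (ForestWithout-≅ (≅-sym i) F))

-- Degrees

count : ∀ {n} → (Fin n → Bool) → ℕ
count {zero}  f = 0
count {suc n} f = (if f zero then 1 else 0) + count (f ∘ suc)

degree≡count : ∀ {n} (G : Graph n) v → degree G v ≡ count (adj G v)
degree≡count {n} G v = go id
  where
  go : ∀ {k} (h : Fin k → Fin n) →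
       sum (List.map (λ u → if adj G v u then 1 else 0) (tabulate h)) ≡ count (adj G v ∘ h)
  go {zero}  h = refl
  go {suc k} h = cong (_ +_) (go (h ∘ suc))

count-cong : ∀ {n} {f g : Fin n → Bool} → (∀ i → f i ≡ g i) → count f ≡ count g
count-cong {zero}  e = refl
count-cong {suc n} e = cong₂ _+_ (cong (λ b → if b then 1 else 0) (e zero)) (count-cong (e ∘ suc))

count-false : ∀ {n} {f : Fin n → Bool} → (∀ i → f i ≡ false) → count f ≡ 0
count-false {zero}  e = refl
count-false {suc n} e rewrite e zero = count-false (e ∘ suc)

count≡0⇒false : ∀ {n} {f : Fin n → Bool} → count f ≡ 0 → ∀ i → f i ≡ false
count≡0⇒false {suc n} {f} e i with f zero in eq
count≡0⇒false {suc n} {f} e zero    | false = eq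
count≡0⇒false {suc n} {f} e (suc i) | false = count≡0⇒false e i

count-insert : ∀ {n} {f g : Fin n → Bool} u → f u ≡ true → g u ≡ false →
               (∀ w → w ≢ u → f w ≡ g w) → count f ≡ suc (count g)
count-insert zero fu gu e rewrite fu | gu = cong suc (count-cong (λ i → e (suc i) λ ()))
count-insert {f = f} {g} (suc u) fu gu e rewrite e zero (λ ()) =
  trans (cong (_ +_) (count-insert u fu gu (λ w w≢u → e (suc w) (w≢u ∘ suc-injective))))
        (ℕₚ.+-suc _ (count (g ∘ suc)))

_∖_ : ∀ {n} → (Fin n → Bool) → Fin n → Fin n → Bool
(f ∖ u) w = f w ∧ not (eqF w u)

module _ {n} (f : Fin n → Bool) (u : Fin n) where
  ∖-self : (f ∖ u) u ≡ false
  ∖-self with u ≟ u | f u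
  ... | yes _ | true  = refl
  ... | yes _ | false = refl
  ... | no ¬p | _ = contradiction refl ¬p

  ∖-other : ∀ w → w ≢ u → f w ≡ (f ∖ u) w
  ∖-other w w≢u with w ≟ u | f w
  ... | no _ | true  = refl
  ... | no _ | false = refl
  ... | yes p | _ = contradiction p w≢u

  ∖-true : ∀ w → (f ∖ u) w ≡ true → f w ≡ true × w ≢ u
  ∖-true w e with f w | w ≟ u
  ... | true | no w≢u = refl , w≢u

  count-∖ : f u ≡ true → count f ≡ suc (count (f ∖ u))
  count-∖ fu = count-insert u fu ∖-self ∖-other

module _ {n} (G : Graph n) (v : Fin n) where
  degree≡1⇒∃! : degree G v ≡ 1 → ∃[ u ] Adj G v u × (∀ {w} → Adj G v w → w ≡ u)
  degree≡1⇒∃! d with any? (Adj? G v)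
  ... | no ∄ = case trans (sym (trans (sym (degree≡count G v)) d)) (count-false λ w → ¬-not (λ vw → ∄ (w , vw))) of λ ()
  ... | yes (u , vu) = u , vu , λ {w} vw → decidable-stable (w ≟ u) λ w≢u →
    case trans (sym (trans (sym (∖-other (adj G v) u w w≢u)) vw)) (count≡0⇒false rest w) of λ ()
    where
    rest : count (adj G v ∖ u) ≡ 0
    rest = ℕₚ.suc-injective (trans (sym (count-∖ (adj G v) u vu)) (trans (sym (degree≡count G v)) d))

  ∃!⇒degree≡1 : ∀ {u} → Adj G v u → (∀ {w} → Adj G v w → w ≡ u) → degree G v ≡ 1
  ∃!⇒degree≡1 {u} vu uniq = trans (degree≡count G v) (trans (count-∖ (adj G v) u vu)
    (cong suc (count-false λ w → ¬-not (no-other w))))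
    where
    no-other : ∀ w → (adj G v ∖ u) w ≢ true
    no-other w e = let vw , w≢u = ∖-true (adj G v) u w e in w≢u (uniq vw)

  ∃₂!⇒degree≡2 : ∀ {u u′} → u ≢ u′ → Adj G v u → Adj G v u′ →
                 (∀ {w} → Adj G v w → w ≢ u → w ≡ u′) → degree G v ≡ 2
  ∃₂!⇒degree≡2 {u} {u′} u≢u′ vu vu′ uniq = trans (degree≡count G v) (trans (count-∖ (adj G v) u vu)
    (cong suc (trans (count-∖ f u′ (trans (sym (∖-other (adj G v) u u′ (≢-sym u≢u′))) vu′))
      (cong suc (count-false λ w → ¬-not (no-other w))))))
    where
    f = adj G v ∖ u
    no-other : ∀ w → (f ∖ u′) w ≢ true
    no-other w e = let fw , w≢u′ = ∖-true f u′ w e ; vw , w≢u = ∖-true (adj G v) u w fw in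
      w≢u′ (uniq vw w≢u)

isLeaf⇒degree≡1 : ∀ {n} (G : Graph n) v → isLeafᵇ G v ≡ true → degree G v ≡ 1
isLeaf⇒degree≡1 G v e = ℕₚ.≡ᵇ⇒≡ _ _ (subst Bool.T (sym e) tt)

degree≡1⇒isLeaf : ∀ {n} (G : Graph n) v → degree G v ≡ 1 → isLeafᵇ G v ≡ true
degree≡1⇒isLeaf G v = cong (_≡ᵇ 1)

-- Small paths

-- The path is induced: `adjacency` also excludes chords.
record PathMap {n} (G : Graph n) {k} (f : Vector (Fin n) k) : Set where
  field
    injective : Injective _≡_ _≡_ f
    adjacency : ∀ i j → adj G (f i) (f j) ≡ pathAdj k i j

module _ {n} {G : Graph n} where
  path-[_] : ∀ x → PathMap G (x ◃ Vector.[])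
  path-[ x ] = record { injective = λ { {zero} {zero} _ → refl } ; adjacency = λ { zero zero → adj-irr G x } }

  path-cons : ∀ {k} {f : Vector (Fin n) (suc k)} {x} → PathMap G f → (∀ i → x ≢ f i) →
              Adj G x (f zero) → (∀ i → ¬ Adj G x (f (suc i))) → PathMap G (x ◃ f)
  path-cons {k} {f} {x} P x∉ x0 ¬x = record { injective = inj ; adjacency = ok }
    where
    open PathMap P
    inj : Injective _≡_ _≡_ (x ◃ f)
    inj {zero} {zero} _ = refl
    inj {zero} {suc j} e = contradiction e (x∉ j)
    inj {suc i} {zero} e = contradiction (sym e) (x∉ i)
    inj {suc i} {suc j} e = cong suc (injective e)
    ok : ∀ i j → adj G ((x ◃ f) i) ((x ◃ f) j) ≡ pathAdj (suc (suc k)) i j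
    ok zero zero = adj-irr G x
    ok zero (suc zero) = x0
    ok zero (suc (suc j)) = ¬-not (¬x j)
    ok (suc zero) zero = Adj-sym G x0
    ok (suc (suc i)) zero = trans (adj-sym G _ _) (¬-not (¬x i))
    ok (suc i) (suc j) = adjacency i j

  path-≅ : ∀ {k} {f : Vector (Fin n) k} → PathMap G f → (∀ x → ∃[ i ] f i ≡ x) → pathGraph k ≅ G
  path-≅ {f = f} P onto = record
    { to = f ; from = proj₁ ∘ onto ; to-from = proj₂ ∘ onto
    ; from-to = λ i → injective (proj₂ (onto (f i))) ; adj-pres = adjacency }
    where open PathMap P

  walk-closed : ∀ {P} {S : Fin n → Set} → (∀ {x y} → S x → Adj G x y → S y) →
                ∀ {x y} → WalkIn G P x y → S x → S y
  walk-closed cl (here _) Sx = Sx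
  walk-closed cl (step _ xy w) Sx = walk-closed cl w (cl Sx xy)

-- Let b have no neighbour other than a. If w is another neighbour of a, then N[w] contains a and
-- isolates b, so every vertex except b lies in N[w]. Two neighbours of w other than a would then be
-- separated by N[a], since a walk between them could start only with an edge inside N(w), giving a
-- triangle. So the path b, a, w, c is the longest possibility.
smallPath-or-minDegree : ∀ {n} (H : Graph n) → Connected H → TriangleFree H → ¬ HasFullStarCutset H →
                         IsSmallPath H ⊎ Core H (λ _ → ⊤)
smallPath-or-minDegree {n} H (_ , conn) tri noFSC
  with all? (λ x → all? (λ y → any? (λ z → Adj? H x z ×-dec ¬? (z ≟ y))))
... | yes core = inj₂ λ x y _ → let z , xz , z≢y = core x y in z , tt , xz , z≢y
... | no ¬core
  with b , ¬all ← ¬∀⟶∃¬ n _ (λ x → all? (λ y → any? (λ z → Adj? H x z ×-dec ¬? (z ≟ y)))) ¬core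
  with a , ∄ ← ¬∀⟶∃¬ n _ (λ y → any? (λ z → Adj? H b z ×-dec ¬? (z ≟ y))) ¬all
  = inj₁ small
  where
  only-a : ∀ {z} → Adj H b z → z ≡ a
  only-a {z} bz = decidable-stable (z ≟ a) λ z≢a → ∄ (z , bz , z≢a)

  cover : ∀ {S : Fin n → Set} → S b → (∀ {x y} → S x → Adj H x y → S y) → ∀ x → S x
  cover Sb cl x = walk-closed cl (conn b x) Sb

  small : IsSmallPath H
  small with Adj? H b a
  ... | no ¬ba = 1 , s≤s z≤n , s≤s z≤n , path-≅ path-[ b ] λ x → zero , sym (cover {_≡ b} refl
    (λ { refl bz → contradiction (subst (Adj H b) (only-a bz) bz) ¬ba }) x)
  ... | yes ba with any? (λ w → Adj? H a w ×-dec ¬? (w ≟ b))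
  ... | no ∄w = 2 , s≤s z≤n , s≤s (s≤s z≤n) ,
    path-≅ (path-cons path-[ a ] (λ { zero refl → Adj⇒≢ H ba refl }) ba (λ ()))
      (cover (zero , refl) λ { {y = y} (zero , refl) by → suc zero , sym (only-a by)
                             ; {y = y} (suc zero , refl) ay → zero , sym (decidable-stable (y ≟ b) λ y≢b → ∄w (y , ay , y≢b)) })
  ... | yes (w , aw , w≢b) = with-w
    where
    b∉N[w] : ¬ InClosedNbhd H w b
    b∉N[w] (inj₁ b≡w) = w≢b (sym b≡w)
    b∉N[w] (inj₂ wb) = Adj⇒≢ H aw (sym (only-a (Adj-sym H wb)))

    near : ∀ x → x ≡ b ⊎ InClosedNbhd H w x
    near x with InClosedNbhd? H w x
    ... | yes x∈ = inj₂ x∈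
    ... | no x∉ with noFullStarCutset⇒connect H noFSC w b∉N[w] x∉
    ... | here _ = inj₁ refl
    ... | step _ bz walk with refl ← only-a bz = contradiction (inj₂ (Adj-sym H aw)) (walk-source walk)

    with-w : IsSmallPath H
    with-w with any? (λ c → Adj? H w c ×-dec ¬? (c ≟ a))
    ... | no ∄c = 3 , s≤s z≤n , s≤s (s≤s (s≤s z≤n)) ,
      path-≅ (path-cons (path-cons path-[ w ] (λ { zero refl → Adj⇒≢ H aw refl }) aw (λ ()))
                        (λ { zero refl → Adj⇒≢ H ba refl ; (suc zero) refl → w≢b refl }) ba
                        (λ { zero bw → b∉N[w] (inj₂ (Adj-sym H bw)) }))
             onto
      where
      onto : ∀ x → ∃[ i ] _ ≡ x
      onto x with near x
      ... | inj₁ refl = zero , refl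
      ... | inj₂ (inj₁ refl) = suc (suc zero) , refl
      ... | inj₂ (inj₂ wx) = suc zero , sym (decidable-stable (x ≟ a) λ x≢a → ∄c (x , wx , x≢a))
    ... | yes (c , wc , c≢a) = 4 , s≤s z≤n , s≤s (s≤s (s≤s (s≤s z≤n))) ,
      path-≅ (path-cons (path-cons (path-cons path-[ c ] (λ { zero refl → Adj⇒≢ H wc refl }) wc (λ ()))
                          (λ { zero refl → Adj⇒≢ H aw refl ; (suc zero) refl → c≢a refl }) aw
                          (λ { zero ac → tri a w c aw wc ac }))
                        (λ { zero refl → Adj⇒≢ H ba refl ; (suc zero) refl → w≢b refl
                           ; (suc (suc zero)) refl → b∉N[w] (inj₂ wc) }) ba
                        (λ { zero bw → b∉N[w] (inj₂ (Adj-sym H bw)) ; (suc zero) bc → c≢a (only-a bc) }))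
             onto
      where
      ∉N[a] : ∀ {d} → Adj H w d → d ≢ a → ¬ InClosedNbhd H a d
      ∉N[a] wd d≢a (inj₁ d≡a) = d≢a d≡a
      ∉N[a] wd d≢a (inj₂ ad) = tri a w _ aw wd ad

      only-c : ∀ {d} → Adj H w d → d ≢ a → d ≡ c
      only-c wd d≢a with noFullStarCutset⇒connect H noFSC a (∉N[a] wc c≢a) (∉N[a] wd d≢a)
      ... | here _ = refl
      ... | step {y = y} _ cy walk with near y
      ... | inj₁ refl = contradiction (inj₂ (Adj-sym H ba)) (walk-source walk)
      ... | inj₂ (inj₁ refl) = contradiction (inj₂ aw) (walk-source walk)
      ... | inj₂ (inj₂ wy) = ⊥-elim (tri w c y wc cy wy)

      onto : ∀ x → ∃[ i ] _ ≡ x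
      onto x with near x
      ... | inj₁ refl = zero , refl
      ... | inj₂ (inj₁ refl) = suc (suc zero) , refl
      ... | inj₂ (inj₂ wx) with x ≟ a
      ... | yes refl = suc zero , refl
      ... | no x≢a = suc (suc (suc zero)) , sym (only-c wx x≢a)

-- Chandeliers

-- Two neighbours y, y′ of x joined by a walk avoiding x yield a closed walk through x, which after
-- removal of backtracking supports a core.
module ClosedWalk {n} {G : Graph n} {p} (F : ForestWithout G p) {x} (x≢p : x ≢ p) where

  -- Route E v s: a walk without backtracking in G − p from v with first step s, which enters x only
  -- at its end, from a vertex satisfying E.
  data Route (E : Fin n → Set) : Fin n → Fin n → Set where
    last : ∀ {v} → E v → v ≢ p → Adj G v x → Route E v x
    go   : ∀ {v t s} → v ≢ p → Adj G v t → t ≢ x → s ≢ v → Route E t s → Route E v t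

  walk⇒Route : ∀ {v e} → Adj G e x → WalkIn G (λ z → z ≢ p × z ≢ x) v e → ∃ (Route (_≡ e) v)
  walk⇒Route ex (here (v≢p , _)) = x , last refl v≢p ex
  walk⇒Route {v} ex (step (v≢p , v≢x) vt w) with walk⇒Route ex w
  ... | s , r with s ≟ v
  ... | no s≢v = _ , go v≢p vt (proj₂ (walk-source w)) s≢v r
  walk⇒Route ex (step (v≢p , v≢x) vt w) | _ , last _ _ _ | yes refl = contradiction refl v≢x
  -- The route from t would return to v at once; both steps cancel, and its remainder already starts
  -- at v.
  walk⇒Route ex (step (v≢p , v≢x) vt w) | _ , go _ _ _ _ r | yes refl = _ , r

  weaken : ∀ {E v s} → Route E v s → Route (λ _ → ⊤) v s
  weaken (last _ v≢p a) = last tt v≢p a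
  weaken (go v≢p a t≢x s≢v r) = go v≢p a t≢x s≢v (weaken r)

  -- A direction in which x can be reached from v without ever turning back.
  Continue : Fin n → Fin n → Set
  Continue v s = Adj G v s × (s ≡ x ⊎ ∃[ t ] t ≢ v × Route (λ _ → ⊤) s t)

  -- Two such directions make v an interior point of a walk from x to x without backtracking (or x
  -- itself). As this is a property of v alone, no list of visited vertices is needed.
  OnClosedWalk : Fin n → Set
  OnClosedWalk v = v ≢ p × ∃[ s ] ∃[ s′ ] s ≢ s′ × Continue v s × Continue v s′

  module _ {y y′} (y≢y′ : y ≢ y′) (xy : Adj G x y) (xy′ : Adj G x y′)
           (w : WalkIn G (λ z → z ≢ p × z ≢ x) y y′) where
    private
      continue-x : ∀ {y y′} → y ≢ y′ → Adj G x y → Adj G x y′ →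
                   WalkIn G (λ z → z ≢ p × z ≢ x) y y′ → Continue x y
      continue-x y≢y′ xy xy′ w with walk⇒Route (Adj-sym G xy′) w
      ... | _ , last e _ _ = contradiction e y≢y′
      ... | s , r@(go _ _ s≢x _ _) = xy , inj₂ (s , s≢x , weaken r)

      x-on : OnClosedWalk x
      x-on = x≢p , y , y′ , y≢y′ , continue-x y≢y′ xy xy′ w , continue-x (≢-sym y≢y′) xy′ xy (walk-reverse w)

      -- Having moved from v to s, one can turn towards v and follow the other direction s′ from
      -- there. This supplies the second direction at s.
      back : ∀ {v s s′} → v ≢ p → s ≢ s′ → Adj G v s → Continue v s′ → Continue s v
      back {v} {s} {s′} v≢p s≢s′ vs (vs′ , c) with v ≟ x | s′ ≟ x | c
      ... | yes v≡x | _ | _ = Adj-sym G vs , inj₁ v≡x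
      ... | no _ | yes refl | _ = Adj-sym G vs , inj₂ (x , ≢-sym s≢s′ , last tt v≢p vs′)
      ... | no _ | no s′≢x | inj₁ s′≡x = contradiction s′≡x s′≢x
      ... | no _ | no s′≢x | inj₂ (t , t≢v , r) =
        Adj-sym G vs , inj₂ (s′ , ≢-sym s≢s′ , go v≢p vs′ s′≢x t≢v r)

      next-on : ∀ {v s s′} → v ≢ p → s ≢ s′ → Continue v s → Continue v s′ → OnClosedWalk s
      next-on v≢p s≢s′ (vs , inj₁ refl) c′ = x-on
      next-on v≢p s≢s′ (vs , inj₂ (t , t≢v , last _ s≢p sx)) c′ =
        s≢p , t , _ , t≢v , (sx , inj₁ refl) , back v≢p s≢s′ vs c′
      next-on v≢p s≢s′ (vs , inj₂ (t , t≢v , go s≢p st t≢x u≢s r)) c′ =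
        s≢p , t , _ , t≢v , (st , inj₂ (_ , u≢s , r)) , back v≢p s≢s′ vs c′

      core : Core G OnClosedWalk
      core v z (v≢p , s , s′ , s≢s′ , c , c′) with s ≟ z
      ... | no s≢z = s , next-on v≢p s≢s′ c c′ , proj₁ c , s≢z
      ... | yes refl = s′ , next-on v≢p (≢-sym s≢s′) c′ c , proj₁ c′ , ≢-sym s≢s′

    no-second-route : ⊥
    no-second-route = F OnClosedWalk (λ p-on → proj₁ p-on refl) core x x-on

cycle-neighbours : ∀ {n} {G : Graph n} ((k , c , _) : Cycle G) i →
  ∃[ j ] ∃[ j′ ] j ≢ j′ × Adj G (c i) (c j) × Adj G (c i) (c j′)
cycle-neighbours {G = G} (k , c , _ , next , close) zero =
  suc zero , fromℕ _ , (λ ()) , next zero , Adj-sym G close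
cycle-neighbours {G = G} (k , c , _ , next , close) (suc i) with view i
... | ‵fromℕ = inject₁ i , zero , (λ ()) , Adj-sym G (next i) , close
... | ‵inject₁ j = inject₁ (inject₁ j) , suc (suc j) , distinct , Adj-sym G (next i) , next (suc j)
  where
  distinct : inject₁ (inject₁ j) ≢ suc (suc j)
  distinct e = ℕₚ.m≢1+n+m (toℕ j) {1}
    (trans (sym (trans (toℕ-inject₁ (inject₁ j)) (toℕ-inject₁ j))) (cong toℕ e))

module Decompose {m} {H : Graph (suc m)} (R : Robust H) {p} (F : ForestWithout H p) where
  open Robust R

  private
    ι : Fin m → Fin (suc m)
    ι = punchIn p

    T : Graph m
    T = record { adj = λ i j → adj H (ι i) (ι j) ; adj-sym = λ i j → adj-sym H (ι i) (ι j)
               ; adj-irr = λ i → adj-irr H (ι i) }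

    ι≢p : ∀ i → ι i ≢ p
    ι≢p = punchInᵢ≢i p

    preimage : ∀ {x} → x ≢ p → ∃[ i ] ι i ≡ x
    preimage x≢p = punchOut (≢-sym x≢p) , punchIn-punchOut (≢-sym x≢p)

    T≅H : (∀ j → Adj H p (ι j) → degree T j ≡ 1) → (∀ j → degree T j ≡ 1 → Adj H p (ι j)) →
          chandelier T ≅ H
    T≅H toLeaf fromLeaf = record
      { to = to ; from = from ; to-from = to-from
      ; from-to = λ x → to-inj (to-from (to x)) ; adj-pres = pres }
      where
      to : Fin (suc m) → Fin (suc m)
      to zero = p
      to (suc j) = ι j
      from : Fin (suc m) → Fin (suc m)
      from x with x ≟ p
      ... | yes _ = zero
      ... | no x≢p = suc (proj₁ (preimage x≢p))
      to-from : ∀ y → to (from y) ≡ y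
      to-from y with y ≟ p
      ... | yes y≡p = sym y≡p
      ... | no y≢p = proj₂ (preimage y≢p)
      to-inj : ∀ {x y} → to x ≡ to y → x ≡ y
      to-inj {zero} {zero} _ = refl
      to-inj {zero} {suc j} e = contradiction (sym e) (ι≢p j)
      to-inj {suc i} {zero} e = contradiction e (ι≢p i)
      to-inj {suc i} {suc j} e = cong suc (punchIn-injective p i j e)
      leaf : ∀ j → adj H p (ι j) ≡ isLeafᵇ T j
      leaf j = bool-ext (degree≡1⇒isLeaf T j ∘ toLeaf j) (fromLeaf j ∘ isLeaf⇒degree≡1 T j)
      pres : ∀ u v → adj H (to u) (to v) ≡ adj (chandelier T) u v
      pres zero zero = adj-irr H p
      pres zero (suc j) = leaf j
      pres (suc i) zero = trans (adj-sym H (ι i) p) (leaf i)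
      pres (suc i) (suc j) = refl

    degree≡1⇒Adj : ∀ j → degree T j ≡ 1 → Adj H p (ι j)
    degree≡1⇒Adj j d with degree≡1⇒∃! T j d
    ... | u , ju , uniq with branch (ι j) (ι u)
    ... | z , jz , z≢u with z ≟ p
    ... | yes refl = Adj-sym H jz
    ... | no z≢p with preimage z≢p
    ... | i , refl = contradiction (cong ι (uniq jz)) z≢u

    -- As p lies in N[x], everything outside N[x] avoids p. Both y and y′ escape to that part, which
    -- is connected, and so they close a walk through x in H - p.
    no-fork : ∀ {x y y′} → Adj H p x → y ≢ p → y′ ≢ p → y ≢ y′ → Adj H x y → Adj H x y′ → ⊥
    no-fork {x} {y} {y′} px y≢p y′≢p y≢y′ xy xy′ with escape xy | escape xy′
    ... | v , yv , v∉ | v′ , yv′ , v′∉ =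
      ClosedWalk.no-second-route {G = H} F {x} (≢-sym (Adj⇒≢ H px)) y≢y′ xy xy′
        (step (y≢p , ≢-sym (Adj⇒≢ H xy)) yv
          (walk-++ (walk-map id (λ z∉ → (λ { refl → z∉ (inj₂ (Adj-sym H px)) }) , z∉ ∘ inj₁) (λ _ _ → id)
                     (connect x v∉ v′∉))
            (step ((λ { refl → v′∉ (inj₂ (Adj-sym H px)) }) , v′∉ ∘ inj₁) (Adj-sym H yv′)
              (here (y′≢p , ≢-sym (Adj⇒≢ H xy′))))))

    Adj⇒degree≡1 : ∀ j → Adj H p (ι j) → degree T j ≡ 1
    Adj⇒degree≡1 j pj with branch (ι j) p
    ... | y , jy , y≢p with preimage y≢p
    ... | u , refl = ∃!⇒degree≡1 T j jy λ {w} jw → decidable-stable (w ≟ u) λ w≢u →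
      no-fork pj (ι≢p w) y≢p (w≢u ∘ punchIn-injective p w u) jw jy

    -- N[l] contains both p and u. Two neighbours of u other than l would be joined outside N[l] and
    -- thus close a walk through u in H - p; minimum degree two and triangle-freeness provide one
    -- such neighbour other than p.
    luxury : LuxuryCondition T
    luxury l u d lu with degree≡1⇒Adj l d | branch (ι u) (ι l)
    ... | pl | z , uz , z≢l with preimage {z} (λ { refl → triangleFree p (ι l) (ι u) pl lu (Adj-sym H uz) })
    ... | i , refl = ∃₂!⇒degree≡2 T u {l} {i} (λ { refl → z≢l refl }) (Adj-sym H lu) uz
      λ {w} uw w≢l → decidable-stable (w ≟ i) λ w≢i →
        ClosedWalk.no-second-route {G = H} F {ι u} (ι≢p u) (w≢i ∘ punchIn-injective p w i) uw uz
          (walk-map id (λ z∉ → (λ { refl → z∉ (inj₂ (Adj-sym H pl)) }) , λ { refl → z∉ (inj₂ lu) }) (λ _ _ → id)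
            (connect (ι l) (beyond uw (w≢l ∘ punchIn-injective p w l)) (beyond uz z≢l)))
      where
      beyond : ∀ {z} → Adj H (ι u) z → z ≢ ι l → ¬ InClosedNbhd H (ι l) z
      beyond uz z≢l (inj₁ e) = z≢l e
      beyond uz z≢l (inj₂ lz) = triangleFree (ι l) (ι u) _ lu uz lz

    walk-restrict : ∀ {i j} → WalkIn H (_≢ p) (ι i) (ι j) → WalkIn T (λ _ → ⊤) i j
    walk-restrict {i} {j} w = subst (λ k → WalkIn T _ k j) (back-ι i)
      (subst (λ k → WalkIn T _ (back (ι i)) k) (back-ι j) (walk-map back (λ _ → tt) pres w))
      where
      back : Fin (suc m) → Fin m
      back x with x ≟ p
      -- An arbitrary value at p, which the walk avoids.
      ... | yes _ = i
      ... | no x≢p = proj₁ (preimage x≢p)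
      ι-back : ∀ {x} → x ≢ p → ι (back x) ≡ x
      ι-back {x} x≢p with x ≟ p
      ... | yes x≡p = contradiction x≡p x≢p
      ... | no x≢p′ = proj₂ (preimage x≢p′)
      back-ι : ∀ k → back (ι k) ≡ k
      back-ι k = punchIn-injective p _ _ (ι-back (ι≢p k))
      pres : ∀ {x y} → x ≢ p → y ≢ p → Adj H x y → Adj T (back x) (back y)
      pres x≢p y≢p = trans (cong₂ (adj H) (ι-back x≢p) (ι-back y≢p))

    -- A neighbour of p has a neighbour outside N[p], where any two vertices are joined.
    connected : Connected T
    connected = nonempty , λ i j →
      let x , x∉ , v = reach (ι≢p i) ; y , y∉ , w = reach (ι≢p j) in
      walk-restrict (walk-++ v (walk-++
        (walk-map id (_∘ inj₁) (λ _ _ → id) (connect p x∉ y∉)) (walk-reverse w)))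
      where
      nonempty : 0 ℕ.< m
      nonempty with branch p p
      ... | z , _ , z≢p with preimage z≢p
      ... | zero , _ = s≤s z≤n
      ... | suc _ , _ = s≤s z≤n
      reach : ∀ {x} → x ≢ p → ∃[ y ] (¬ InClosedNbhd H p y) × WalkIn H (_≢ p) x y
      reach {x} x≢p with InClosedNbhd? H p x
      ... | no x∉ = x , x∉ , here x≢p
      ... | yes (inj₁ x≡p) = contradiction x≡p x≢p
      ... | yes (inj₂ px) with escape px
      ... | y , xy , y∉ = y , y∉ , step x≢p xy (here (y∉ ∘ inj₁))

    acyclic : ¬ Cycle T
    acyclic C@(k , c , c-inj , _) = F (λ x → ∃[ i ] x ≡ ι (c i)) (λ (i , e) → ι≢p (c i) (sym e)) core
      (ι (c zero)) (zero , refl)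
      where
      core : Core H (λ x → ∃[ i ] x ≡ ι (c i))
      core _ y (i , refl) with cycle-neighbours {G = T} C i
      ... | j , j′ , j≢j′ , ij , ij′ with ι (c j) ≟ y
      ... | no ≢y = ι (c j) , (j , refl) , ij , ≢y
      ... | yes refl = ι (c j′) , (j′ , refl) , ij′ , λ e → j≢j′ (sym (c-inj (punchIn-injective p _ _ e)))

  robust⇒luxuryChandelier : IsLuxuryChandelier H
  robust⇒luxuryChandelier = m , T , (connected , acyclic) , luxury , T≅H Adj⇒degree≡1 degree≡1⇒Adj

-- Frames

≤∧≢⇒<ℚ : ∀ {p q} → p ≤ℚ q → p ≢ q → p <ℚ q
≤∧≢⇒<ℚ p≤q p≢q = ℚₚ.≰⇒> λ q≤p → p≢q (ℚₚ.≤-antisym p≤q q≤p)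

<⇒≱ℚ : ∀ {p q} → p <ℚ q → ¬ (q ≤ℚ p)
<⇒≱ℚ p<q q≤p = ℚₚ.<-irrefl refl (ℚₚ.<-≤-trans p<q q≤p)

-- Enters F G says that G crosses the right side of F, which is the only way in which two frames of a
-- restricted frame graph can intersect.
record Enters (F G : Frame) : Set where
  constructor enters
  field
    xl<xl : xl F <ℚ xl G
    xl<xr′ : xl G <ℚ xr F
    xr<xr : xr F <ℚ xr G
    yb<yb : yb F <ℚ yb G
    yt<yt : yt G <ℚ yt F

record Inside (F G : Frame) : Set where
  constructor inside
  field
    xl<xl : xl G <ℚ xl F
    xr<xr : xr F <ℚ xr G
    yb<yb : yb G <ℚ yb F
    yt<yt : yt F <ℚ yt G

Enters? : ∀ F G → Dec (Enters F G)
Enters? F G with xl F ℚₚ.<? xl G | xl G ℚₚ.<? xr F | xr F ℚₚ.<? xr G | yb F ℚₚ.<? yb G | yt G ℚₚ.<? yt F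
... | yes a | yes b | yes c | yes d | yes e = yes (enters a b c d e)
... | no ¬a | _ | _ | _ | _ = no (¬a ∘ Enters.xl<xl)
... | _ | no ¬a | _ | _ | _ = no (¬a ∘ Enters.xl<xr′)
... | _ | _ | no ¬a | _ | _ = no (¬a ∘ Enters.xr<xr)
... | _ | _ | _ | no ¬a | _ = no (¬a ∘ Enters.yb<yb)
... | _ | _ | _ | _ | no ¬a = no (¬a ∘ Enters.yt<yt)

Inside? : ∀ F G → Dec (Inside F G)
Inside? F G with xl G ℚₚ.<? xl F | xr F ℚₚ.<? xr G | yb G ℚₚ.<? yb F | yt F ℚₚ.<? yt G
... | yes a | yes b | yes c | yes d = yes (inside a b c d)
... | no ¬a | _ | _ | _ = no (¬a ∘ Inside.xl<xl)
... | _ | no ¬a | _ | _ = no (¬a ∘ Inside.xr<xr)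
... | _ | _ | no ¬a | _ = no (¬a ∘ Inside.yb<yb)
... | _ | _ | _ | no ¬a = no (¬a ∘ Inside.yt<yt)

Inside-trans : ∀ {F G H} → Inside F G → Inside G H → Inside F H
Inside-trans (inside a b c d) (inside a′ b′ c′ d′) =
  inside (ℚₚ.<-trans a′ a) (ℚₚ.<-trans b b′) (ℚₚ.<-trans c′ c) (ℚₚ.<-trans d d′)

Inside-irrefl : ∀ {F} → ¬ Inside F F
Inside-irrefl i = ℚₚ.<-irrefl refl (Inside.xl<xl i)

Enters⇒¬Inside : ∀ {F G} → Enters F G ⊎ Enters G F → ¬ Inside F G
Enters⇒¬Inside (inj₁ e) i = ℚₚ.<-asym (Enters.xl<xl e) (Inside.xl<xl i)
Enters⇒¬Inside (inj₂ e) i = ℚₚ.<-asym (Enters.xr<xr e) (Inside.xr<xr i)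

-- The interiors of the two regions meet.
record Overlap (F G : Frame) : Set where
  constructor overlapping
  field
    l<r : xl F <ℚ xr G
    l<r′ : xl G <ℚ xr F
    b<t : yb F <ℚ yt G
    b<t′ : yb G <ℚ yt F

Overlap-sym : ∀ {F G} → Overlap F G → Overlap G F
Overlap-sym (overlapping a b c d) = overlapping b a d c

Intersect-sym : ∀ {F G} → Intersect F G → Intersect G F
Intersect-sym (q , f , g) = q , g , f

common-Enters⇒Overlap : ∀ {F G K} → Enters F K → Enters G K → Overlap F G
common-Enters⇒Overlap {K = K} (enters a b c d e) (enters a′ b′ c′ d′ e′) =
  overlapping (ℚₚ.<-trans a b′) (ℚₚ.<-trans a′ b) (ℚₚ.<-trans d (ℚₚ.<-trans (yb<yt K) e′))
          (ℚₚ.<-trans d′ (ℚₚ.<-trans (yb<yt K) e))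

Inside-Enters⇒Overlap : ∀ {F G K} → Inside F K → Enters F G ⊎ Enters G F → Overlap G K
Inside-Enters⇒Overlap {F} {G} {K} (inside a b c d) (inj₁ (enters a′ b′ c′ d′ e′)) =
  overlapping (ℚₚ.<-trans b′ b) (ℚₚ.<-trans a (ℚₚ.<-trans a′ (xl<xr G)))
          (ℚₚ.<-trans (yb<yt G) (ℚₚ.<-trans e′ d)) (ℚₚ.<-trans c (ℚₚ.<-trans d′ (yb<yt G)))
Inside-Enters⇒Overlap {F} {G} {K} (inside a b c d) (inj₂ (enters a′ b′ c′ d′ e′)) =
  overlapping (ℚₚ.<-trans a′ (ℚₚ.<-trans (xl<xr F) b)) (ℚₚ.<-trans a b′)
          (ℚₚ.<-trans d′ (ℚₚ.<-trans (yb<yt F) d)) (ℚₚ.<-trans c (ℚₚ.<-trans (yb<yt F) e′))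

private
  -- Were a side of G not strictly inside F, the two frames would share the point exhibited for that
  -- side. The points for the right and the left side lie at the height of the bottom of G, which
  -- `lower-b` places within F.
  nested : ∀ {F G} → xl F ≤ℚ xl G → Overlap F G → ¬ Intersect F G → Inside G F
  nested {F} {G} l≤l (overlapping l<r l<r′ b<t b<t′) ¬FG = inside lower-l lower-r lower-b lower-t
    where
    lower-b : yb F <ℚ yb G
    lower-b = ℚₚ.≰⇒> λ b≤b → ¬FG ((xl G , yb F) , inj₂ (inj₂ (inj₂ (refl , l≤l , ℚₚ.<⇒≤ l<r′))) ,
      inj₁ (refl , b≤b , ℚₚ.<⇒≤ b<t))
    lower-t : yt G <ℚ yt F
    lower-t = ℚₚ.≰⇒> λ t≤t → ¬FG ((xl G , yt F) , inj₂ (inj₂ (inj₁ (refl , l≤l , ℚₚ.<⇒≤ l<r′))) ,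
      inj₁ (refl , ℚₚ.<⇒≤ b<t′ , t≤t))
    lower-r : xr G <ℚ xr F
    lower-r = ℚₚ.≰⇒> λ r≤r → ¬FG ((xr F , yb G) , inj₂ (inj₁ (refl , ℚₚ.<⇒≤ lower-b , ℚₚ.<⇒≤ b<t′)) ,
      inj₂ (inj₂ (inj₂ (refl , ℚₚ.<⇒≤ l<r′ , r≤r))))
    lower-l : xl F <ℚ xl G
    lower-l = ≤∧≢⇒<ℚ l≤l λ l≡l → ¬FG ((xl F , yb G) , inj₁ (refl , ℚₚ.<⇒≤ lower-b , ℚₚ.<⇒≤ b<t′) ,
      inj₁ (l≡l , ℚₚ.≤-refl , ℚₚ.<⇒≤ (yb<yt G)))

Overlap⇒nested : ∀ {F G} → Overlap F G → ¬ Intersect F G → Inside G F ⊎ Inside F G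
Overlap⇒nested {F} {G} o ¬FG with ℚₚ.≤-total (xl F) (xl G)
... | inj₁ l≤l = inj₁ (nested l≤l o ¬FG)
... | inj₂ l≤l = inj₂ (nested l≤l (Overlap-sym o) (¬FG ∘ Intersect-sym {G} {F}))

OnFrame⇒InRegion : ∀ F {q} → OnFrame F q → InRegion F q
OnFrame⇒InRegion F (inj₁ (refl , b , t)) = ℚₚ.≤-refl , ℚₚ.<⇒≤ (xl<xr F) , b , t
OnFrame⇒InRegion F (inj₂ (inj₁ (refl , b , t))) = ℚₚ.<⇒≤ (xl<xr F) , ℚₚ.≤-refl , b , t
OnFrame⇒InRegion F (inj₂ (inj₂ (inj₁ (refl , l , r)))) = l , r , ℚₚ.<⇒≤ (yb<yt F) , ℚₚ.≤-refl
OnFrame⇒InRegion F (inj₂ (inj₂ (inj₂ (refl , l , r)))) = l , r , ℚₚ.≤-refl , ℚₚ.<⇒≤ (yb<yt F)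

interior⇒¬OnFrame : ∀ F {x y} → xl F <ℚ x → x <ℚ xr F → yb F <ℚ y → y <ℚ yt F → ¬ OnFrame F (x , y)
interior⇒¬OnFrame F l r b t (inj₁ (refl , _)) = ℚₚ.<-irrefl refl l
interior⇒¬OnFrame F l r b t (inj₂ (inj₁ (refl , _))) = ℚₚ.<-irrefl refl r
interior⇒¬OnFrame F l r b t (inj₂ (inj₂ (inj₁ (refl , _)))) = ℚₚ.<-irrefl refl t
interior⇒¬OnFrame F l r b t (inj₂ (inj₂ (inj₂ (refl , _)))) = ℚₚ.<-irrefl refl b

corner⇒OnFrame : ∀ F {q} → IsCorner F q → OnFrame F q
corner⇒OnFrame F (inj₁ refl) = inj₁ (refl , ℚₚ.≤-refl , ℚₚ.<⇒≤ (yb<yt F))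
corner⇒OnFrame F (inj₂ (inj₁ refl)) = inj₁ (refl , ℚₚ.<⇒≤ (yb<yt F) , ℚₚ.≤-refl)
corner⇒OnFrame F (inj₂ (inj₂ (inj₁ refl))) = inj₂ (inj₁ (refl , ℚₚ.≤-refl , ℚₚ.<⇒≤ (yb<yt F)))
corner⇒OnFrame F (inj₂ (inj₂ (inj₂ refl))) = inj₂ (inj₁ (refl , ℚₚ.<⇒≤ (yb<yt F) , ℚₚ.≤-refl))

below⇒¬Intersect : ∀ {A B} → yt A <ℚ yb B → ¬ Intersect A B
below⇒¬Intersect {A} {B} t<b (q , a , b) =
  let _ , _ , _ , y≤t = OnFrame⇒InRegion A a ; _ , _ , b≤y , _ = OnFrame⇒InRegion B b in
  <⇒≱ℚ t<b (ℚₚ.≤-trans b≤y y≤t)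

left⇒¬Intersect : ∀ {A B} → xr A <ℚ xl B → ¬ Intersect A B
left⇒¬Intersect {A} {B} r<l (q , a , b) =
  let _ , x≤r , _ = OnFrame⇒InRegion A a ; l≤x , _ = OnFrame⇒InRegion B b in
  <⇒≱ℚ r<l (ℚₚ.≤-trans l≤x x≤r)

Inside⇒¬Intersect : ∀ {A B} → Inside B A → ¬ Intersect A B
Inside⇒¬Intersect {A} {B} (inside l r b t) (q , onA , onB) =
  let l≤x , x≤r , b≤y , y≤t = OnFrame⇒InRegion B onB in
  interior⇒¬OnFrame A (ℚₚ.<-≤-trans l l≤x) (ℚₚ.≤-<-trans x≤r r) (ℚₚ.<-≤-trans b b≤y) (ℚₚ.≤-<-trans y≤t t) onA

module _ {A B : Frame} (e : Enters A B) where
  open Enters e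

  private
    in-y : ∀ {y} → yb B ≤ℚ y → y ≤ℚ yt B → yb A <ℚ y × y <ℚ yt A
    in-y b t = ℚₚ.<-≤-trans yb<yb b , ℚₚ.≤-<-trans t yt<yt

    inside-left : ∀ {y} → yb B ≤ℚ y → y ≤ℚ yt B → ¬ OnFrame A (xl B , y)
    inside-left b t = let b′ , t′ = in-y b t in interior⇒¬OnFrame A xl<xl xl<xr′ b′ t′

    outside-right : ∀ {y} → ¬ OnFrame A (xr B , y)
    outside-right on = let _ , x≤r , _ = OnFrame⇒InRegion A on in <⇒≱ℚ xr<xr x≤r

    outside-below : ∀ {x} → ¬ OnFrame B (x , yb A)
    outside-below on = let _ , _ , b≤y , _ = OnFrame⇒InRegion B on in <⇒≱ℚ yb<yb b≤y

    outside-above : ∀ {x} → ¬ OnFrame B (x , yt A)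
    outside-above on = let _ , _ , _ , y≤t = OnFrame⇒InRegion B on in <⇒≱ℚ yt<yt y≤t

  Enters-corner : ∀ q → IsCorner A q → ¬ OnFrame B q
  Enters-corner _ (inj₁ refl) = outside-below
  Enters-corner _ (inj₂ (inj₁ refl)) = outside-above
  Enters-corner _ (inj₂ (inj₂ (inj₁ refl))) = outside-below
  Enters-corner _ (inj₂ (inj₂ (inj₂ refl))) = outside-above

  Enters-corner′ : ∀ q → IsCorner B q → ¬ OnFrame A q
  Enters-corner′ _ (inj₁ refl) = inside-left ℚₚ.≤-refl (ℚₚ.<⇒≤ (yb<yt B))
  Enters-corner′ _ (inj₂ (inj₁ refl)) = inside-left (ℚₚ.<⇒≤ (yb<yt B)) ℚₚ.≤-refl
  Enters-corner′ _ (inj₂ (inj₂ (inj₁ refl))) = outside-right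
  Enters-corner′ _ (inj₂ (inj₂ (inj₂ refl))) = outside-right

  Enters-left : ¬ Meet (OnLeft A) (OnFrame B)
  Enters-left (_ , (refl , _) , on) = let l≤x , _ = OnFrame⇒InRegion B on in <⇒≱ℚ xl<xl l≤x

  Enters-left′ : ¬ Meet (OnLeft B) (OnFrame A)
  Enters-left′ (_ , (refl , b , t) , on) = inside-left b t on

  Enters-right′ : ¬ Meet (OnRight B) (OnFrame A)
  Enters-right′ (_ , (refl , _) , on) = outside-right on

  Enters-top : Meet (OnRight A) (OnTop B)
  Enters-top = let b , t = in-y (ℚₚ.<⇒≤ (yb<yt B)) ℚₚ.≤-refl in
    (xr A , yt B) , (refl , ℚₚ.<⇒≤ b , ℚₚ.<⇒≤ t) , (refl , ℚₚ.<⇒≤ xl<xr′ , ℚₚ.<⇒≤ xr<xr)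

  Enters-bottom : Meet (OnRight A) (OnBottom B)
  Enters-bottom = let b , t = in-y ℚₚ.≤-refl (ℚₚ.<⇒≤ (yb<yt B)) in
    (xr A , yb B) , (refl , ℚₚ.<⇒≤ b , ℚₚ.<⇒≤ t) , (refl , ℚₚ.<⇒≤ xl<xr′ , ℚₚ.<⇒≤ xr<xr)

  Enters⇒Intersect : Intersect A B
  Enters⇒Intersect = let q , a , b = Enters-bottom in q , inj₂ (inj₁ a) , inj₂ (inj₂ (inj₂ b))

Within : Frame → Frame → Set
Within A B = ∀ q → OnFrame A q → InRegion B q

Within⇒≤ : ∀ {A B} → Within A B → xl B ≤ℚ xl A × xr A ≤ℚ xr B × yb B ≤ℚ yb A × yt A ≤ℚ yt B
Within⇒≤ {A} w =
  let l , _ , b , _ = w _ (corner⇒OnFrame A (inj₁ refl))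
      _ , r , _ , t = w _ (corner⇒OnFrame A (inj₂ (inj₂ (inj₂ refl)))) in l , r , b , t

module _ {n} (Fs : Fin n → Frame) (c1 : Cond1 Fs) (c2 : Cond2 Fs) (c3 : Cond3 Fs) where
  -- Condition (3) gives all inequalities but the first in weak form, and an equality would put a
  -- corner on the other frame. If v started no further right than u, the left side of u would meet
  -- the top of v, against condition (2).
  right-Meet⇒Enters : ∀ {u v} → u ≢ v → Meet (OnRight (Fs u)) (OnFrame (Fs v)) → Enters (Fs u) (Fs v)
  right-Meet⇒Enters {u} {v} u≢v m with c3 u v u≢v m
  ... | ((x , y) , (refl , b≤y , y≤t) , (refl , l≤x , x≤r)) , ((_ , y′) , (refl , b≤y′ , y′≤t) , (refl , _ , _)) =
    enters
      (ℚₚ.≰⇒> λ l≤l → c2 u v u≢v ((xl (Fs u) , yt (Fs v)) , (refl , b≤y , y≤t) ,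
        inj₂ (inj₂ (inj₁ (refl , l≤l , ℚₚ.≤-trans (ℚₚ.<⇒≤ (xl<xr (Fs u))) x≤r)))))
      (≤∧≢⇒<ℚ l≤x λ e → c1 v u (≢-sym u≢v) (xl (Fs v) , yt (Fs v)) (inj₂ (inj₁ refl)) (inj₂ (inj₁ (e , b≤y , y≤t))))
      (≤∧≢⇒<ℚ x≤r λ e → c1 v u (≢-sym u≢v) (xr (Fs v) , yt (Fs v)) (inj₂ (inj₂ (inj₂ refl))) (inj₂ (inj₁ (sym e , b≤y , y≤t))))
      (≤∧≢⇒<ℚ b≤y′ λ e → c1 u v u≢v (xr (Fs u) , yb (Fs u)) (inj₂ (inj₂ (inj₁ refl))) (inj₂ (inj₂ (inj₂ (e , l≤x , x≤r)))))
      (≤∧≢⇒<ℚ y≤t λ e → c1 u v u≢v (xr (Fs u) , yt (Fs u)) (inj₂ (inj₂ (inj₂ refl))) (inj₂ (inj₂ (inj₁ (sym e , l≤x , x≤r)))))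

  private
    OnHorizontal : Frame → Point → Set
    OnHorizontal F (x , y) = (y ≡ yt F ⊎ y ≡ yb F) × xl F ≤ℚ x × x ≤ℚ xr F

    horizontal⇒OnFrame : ∀ F {q} → OnHorizontal F q → OnFrame F q
    horizontal⇒OnFrame F (inj₁ y , x) = inj₂ (inj₂ (inj₁ (y , x)))
    horizontal⇒OnFrame F (inj₂ y , x) = inj₂ (inj₂ (inj₂ (y , x)))

    left-corner : ∀ F {y} → y ≡ yt F ⊎ y ≡ yb F → IsCorner F (xl F , y)
    left-corner F (inj₁ refl) = inj₂ (inj₁ refl)
    left-corner F (inj₂ refl) = inj₁ refl

    sides : ∀ F {q} → OnFrame F q → OnLeft F q ⊎ OnRight F q ⊎ OnHorizontal F q
    sides F (inj₁ l) = inj₁ l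
    sides F (inj₂ (inj₁ r)) = inj₂ (inj₁ r)
    sides F (inj₂ (inj₂ (inj₁ (y , x)))) = inj₂ (inj₂ (inj₁ y , x))
    sides F (inj₂ (inj₂ (inj₂ (y , x)))) = inj₂ (inj₂ (inj₂ y , x))

    -- Of two horizontal sides with a common point, the one that starts further right has its left
    -- corner on the other.
    no-horizontal : ∀ {u v} → u ≢ v → ¬ Meet (OnHorizontal (Fs u)) (OnHorizontal (Fs v))
    no-horizontal {u} {v} u≢v ((x , y) , (yu , lu , ru) , (yv , lv , rv)) with ℚₚ.≤-total (xl (Fs u)) (xl (Fs v))
    ... | inj₁ l≤l = c1 v u (≢-sym u≢v) (xl (Fs v) , y) (left-corner (Fs v) yv)
                       (horizontal⇒OnFrame (Fs u) (yu , l≤l , ℚₚ.≤-trans lv ru))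
    ... | inj₂ l≤l = c1 u v u≢v (xl (Fs u) , y) (left-corner (Fs u) yu)
                       (horizontal⇒OnFrame (Fs v) (yv , l≤l , ℚₚ.≤-trans lu rv))

  Intersect⇒Enters : ∀ {u v} → u ≢ v → Intersect (Fs u) (Fs v) → Enters (Fs u) (Fs v) ⊎ Enters (Fs v) (Fs u)
  Intersect⇒Enters {u} {v} u≢v (q , onu , onv) with sides (Fs u) onu | sides (Fs v) onv
  ... | inj₁ l | _ = contradiction (q , l , onv) (c2 u v u≢v)
  ... | inj₂ (inj₁ r) | _ = inj₁ (right-Meet⇒Enters u≢v (q , r , onv))
  ... | inj₂ (inj₂ h) | inj₁ l = contradiction (q , l , onu) (c2 v u (≢-sym u≢v))
  ... | inj₂ (inj₂ h) | inj₂ (inj₁ r) = inj₂ (right-Meet⇒Enters (≢-sym u≢v) (q , r , onu))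
  ... | inj₂ (inj₂ h) | inj₂ (inj₂ h′) = contradiction (q , h , h′) (no-horizontal u≢v)

-- Hubs in a restricted frame representation

module _ {n} {G : Graph n} (R : Robust G) (Fs : Fin n → Frame) (rep : Represents Fs G)
         (c1 : Cond1 Fs) (c2 : Cond2 Fs) (c3 : Cond3 Fs) where
  open Robust R

  private
    _⇢_ _⊂_ : Fin n → Fin n → Set
    u ⇢ v = Enters (Fs u) (Fs v)
    u ⊂ v = Inside (Fs u) (Fs v)

    Adj⇒⇢ : ∀ {u v} → Adj G u v → u ⇢ v ⊎ v ⇢ u
    Adj⇒⇢ uv = Intersect⇒Enters Fs c1 c2 c3 (Adj⇒≢ G uv) (proj₁ (rep _ _ (Adj⇒≢ G uv)) uv)

    ⇢⇒≢ : ∀ {u v} → u ⇢ v → u ≢ v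
    ⇢⇒≢ e refl = ℚₚ.<-irrefl refl (Enters.xl<xl e)

    ⇢⇒Adj : ∀ {u v} → u ⇢ v → Adj G u v
    ⇢⇒Adj {u} {v} e = proj₂ (rep u v (⇢⇒≢ e)) (Enters⇒Intersect e)

    ¬Adj⇒nested : ∀ {u v} → u ≢ v → ¬ Adj G u v → Overlap (Fs u) (Fs v) → v ⊂ u ⊎ u ⊂ v
    ¬Adj⇒nested u≢v ¬uv o = Overlap⇒nested o (¬uv ∘ proj₂ (rep _ _ u≢v))

    ⊂⇒∉N : ∀ {u v} → u ⊂ v → ¬ InClosedNbhd G v u
    ⊂⇒∉N u⊂v (inj₁ refl) = Inside-irrefl u⊂v
    ⊂⇒∉N u⊂v (inj₂ vu) = Enters⇒¬Inside (Adj⇒⇢ (Adj-sym G vu)) u⊂v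

    -- A frame that crosses one inside p overlaps p. If it does not meet p it is nested with p, and
    -- it cannot surround p, since it would then surround the frame that it crosses.
    walk-⊂ : ∀ {p x y} → WalkIn G (λ z → ¬ InClosedNbhd G p z) x y → x ⊂ p → y ⊂ p
    walk-⊂ (here _) x⊂p = x⊂p
    walk-⊂ {p} (step {y = y} _ xy w) x⊂p = walk-⊂ w y⊂p
      where
      y∉ = walk-source w
      y⊂p : y ⊂ p
      y⊂p with ¬Adj⇒nested (y∉ ∘ inj₁) (y∉ ∘ inj₂ ∘ Adj-sym G) (Inside-Enters⇒Overlap x⊂p (Adj⇒⇢ xy))
      ... | inj₂ y⊂p = y⊂p
      ... | inj₁ p⊂y = contradiction (Inside-trans x⊂p p⊂y) (Enters⇒¬Inside (Adj⇒⇢ xy))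

    -- Since G − N[p] is connected, once p encloses a frame it encloses all frames outside N[p].
    encloses-all : ∀ {p x y} → x ⊂ p → ¬ InClosedNbhd G p y → y ⊂ p
    encloses-all x⊂p y∉ = walk-⊂ (connect _ (⊂⇒∉N x⊂p) y∉) x⊂p

    Hub : Fin n → Set
    Hub p = ∃[ u ] ∃[ v ] u ⊂ p × p ⇢ v × u ⇢ v

    Hub? : ∀ p → Dec (Hub p)
    Hub? p = any? λ u → any? λ v → Inside? (Fs u) (Fs p) ×-dec (Enters? (Fs p) (Fs v) ×-dec Enters? (Fs u) (Fs v))

    -- If p ⇢ q then the vertex v entered by q is not adjacent to p, hence lies inside p, although it
    -- reaches further to the right than q.
    hubs-not-⇢ : ∀ {p q} → Hub p → Hub q → ¬ p ⇢ q
    hubs-not-⇢ {p} {q} (u , _ , u⊂p , _) (_ , v , _ , q⇢v , _) p⇢q =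
      ℚₚ.<-asym (Inside.xr<xr (encloses-all u⊂p v∉)) (ℚₚ.<-trans (Enters.xr<xr p⇢q) (Enters.xr<xr q⇢v))
      where
      v∉ : ¬ InClosedNbhd G p v
      v∉ (inj₁ refl) = ℚₚ.<-asym (Enters.xl<xl p⇢q) (Enters.xl<xl q⇢v)
      v∉ (inj₂ pv) = triangleFree p q v (⇢⇒Adj p⇢q) (⇢⇒Adj q⇢v) pv

    -- Two non-adjacent hubs would each lie inside the other.
    hub-unique : ∀ {p q} → Hub p → Hub q → p ≡ q
    hub-unique {p} {q} hp hq with p ≟ q
    ... | yes p≡q = p≡q
    ... | no p≢q with Adj? G p q
    ... | yes pq = ⊥-elim ([ hubs-not-⇢ hp hq , hubs-not-⇢ hq hp ]′ (Adj⇒⇢ pq))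
    ... | no ¬pq = ⊥-elim (Inside-irrefl (Inside-trans
      (encloses-all (proj₁ (proj₂ (proj₂ hp))) [ ≢-sym p≢q , ¬pq ]′)
      (encloses-all (proj₁ (proj₂ (proj₂ hq))) [ p≢q , ¬pq ∘ Adj-sym G ]′)))

    hub-of : ∀ {u u′ v} → u ≢ u′ → u ⇢ v → u′ ⇢ v → Hub u ⊎ Hub u′
    hub-of {u} {u′} {v} u≢u′ e e′
      with ¬Adj⇒nested u≢u′ (λ uu′ → triangleFree u u′ v uu′ (⇢⇒Adj e′) (⇢⇒Adj e)) (common-Enters⇒Overlap e e′)
    ... | inj₁ u′⊂u = inj₁ (u′ , v , u′⊂u , e , e′)
    ... | inj₂ u⊂u′ = inj₂ (u , v , u⊂u′ , e′ , e)

    -- Following the arrows forward inside a core never ends, as only one arrow can enter a vertex.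
    only-hub⇒forest : ∀ p → (∀ {q} → Hub q → q ≡ p) → ForestWithout G p
    only-hub⇒forest p only S ¬Sp core x Sx = climb (spo-noetherian order x) Sx
      where
      order : IsStrictPartialOrder _ (λ u v → xl (Fs u) <ℚ xl (Fs v))
      order = On.isStrictPartialOrder (xl ∘ Fs) ℚₚ.<-isStrictPartialOrder

      S⇒≢p : ∀ {z} → S z → z ≢ p
      S⇒≢p Sz refl = ¬Sp Sz

      climb : ∀ {x} → Acc (λ v u → xl (Fs u) <ℚ xl (Fs v)) x → ¬ S x
      climb {x} (acc rs) Sx with core x x Sx
      ... | z , Sz , xz , _ with Adj⇒⇢ xz
      ... | inj₁ x⇢z = climb (rs (Enters.xl<xl x⇢z)) Sz
      ... | inj₂ z⇢x with core x z Sx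
      ... | z′ , Sz′ , xz′ , z′≢z with Adj⇒⇢ xz′
      ... | inj₁ x⇢z′ = climb (rs (Enters.xl<xl x⇢z′)) Sz′
      ... | inj₂ z′⇢x with hub-of z′≢z z′⇢x z⇢x
      ... | inj₁ h = S⇒≢p Sz′ (only h)
      ... | inj₂ h = S⇒≢p Sz (only h)

  restrictedFrame⇒forest : Fin n → ∃ (ForestWithout G)
  restrictedFrame⇒forest v with any? Hub?
  ... | yes (p , hp) = p , only-hub⇒forest p λ hq → hub-unique hq hp
  ... | no ∄ = v , only-hub⇒forest v λ hq → contradiction (_ , hq) ∄

-- Paths and chandeliers have a pivot

path-Adj : ∀ {k} i j → Adj (pathGraph k) i j → toℕ j ≡ suc (toℕ i) ⊎ toℕ i ≡ suc (toℕ j)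
path-Adj i j e with suc (toℕ i) ≡ᵇ toℕ j in p | suc (toℕ j) ≡ᵇ toℕ i in q
... | true | _ = inj₁ (sym (ℕₚ.≡ᵇ⇒≡ _ _ (subst Bool.T (sym p) tt)))
... | false | true = inj₂ (sym (ℕₚ.≡ᵇ⇒≡ _ _ (subst Bool.T (sym q) tt)))

path-Pivot : ∀ k → Pivot (pathGraph (suc k)) zero
path-Pivot k = record { forest = forest ; independent = independent ; pendant = pendant }
  where
  P = pathGraph (suc k)

  forest : ForestWithout P zero
  forest S _ core x = climb (>-wellFounded x)
    where
    climb : ∀ {x} → Acc (λ i j → toℕ j ℕ.< toℕ i) x → ¬ S x
    climb {x} (acc rs) Sx with core x x Sx
    ... | z , Sz , xz , _ with path-Adj x z xz
    ... | inj₁ up = climb (rs (ℕₚ.≤-reflexive (sym up))) Sz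
    ... | inj₂ down with core x z Sx
    ... | z′ , Sz′ , xz′ , z′≢z with path-Adj x z′ xz′
    ... | inj₁ up = climb (rs (ℕₚ.≤-reflexive (sym up))) Sz′
    ... | inj₂ down′ = z′≢z (toℕ-injective (ℕₚ.suc-injective (trans (sym down′) down)))

  first : ∀ l → Adj P zero l → toℕ l ≡ 1
  first l a with path-Adj zero l a
  ... | inj₁ e = e

  independent : ∀ i j → Adj P zero i → Adj P zero j → ¬ Adj P i j
  independent i j 0i 0j ij = Adj⇒≢ P {i} {j} ij (toℕ-injective (trans (first i 0i) (sym (first j 0j))))

  second : ∀ l y → Adj P zero l → y ≢ zero → Adj P l y → toℕ y ≡ 2
  second l y 0l y≢0 ly with path-Adj l y ly
  ... | inj₁ e = trans e (cong suc (first l 0l))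
  ... | inj₂ e = contradiction (toℕ-injective (ℕₚ.suc-injective (trans (sym e) (first l 0l)))) y≢0

  pendant : ∀ l y z → Adj P zero l → y ≢ zero → z ≢ zero → Adj P l y → Adj P l z → y ≡ z
  pendant l y z 0l y≢0 z≢0 ly lz = toℕ-injective (trans (second l y 0l y≢0 ly) (sym (second l z 0l z≢0 lz)))

-- A walk without backtracking inside a core closes up to a cycle at its first repetition.
module CoreCycle {n} (G : Graph n) {S : Fin n → Set} (core : Core G S) {x} (Sx : S x) where
  private
    state : ℕ → Fin n × Σ (Fin n) S
    state zero    = x , x , Sx
    state (suc k) = let prev , cur , Scur = state k ; z , Sz , _ = core cur prev Scur in cur , z , Sz

    f : ℕ → Fin n
    f k = proj₁ (proj₂ (state k))

    f-Adj : ∀ k → Adj G (f k) (f (suc k))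
    f-Adj k = let prev , cur , Scur = state k in proj₁ (proj₂ (proj₂ (core cur prev Scur)))

    f-forward : ∀ k → f (suc (suc k)) ≢ f k
    f-forward k = let prev , cur , Scur = state (suc k) in proj₂ (proj₂ (proj₂ (core cur prev Scur)))

    InjectiveBelow : ℕ → Set
    InjectiveBelow j = ∀ {a b} → a ℕ.< j → b ℕ.< j → f a ≡ f b → a ≡ b

    -- The repetition spans d + 1 steps: one step would be a loop, two would be backtracking, and
    -- more form a cycle of length d + 1.
    close : ∀ i d {j} → suc (i + d) ≡ j → InjectiveBelow j → f i ≡ f j → Cycle G
    close i zero refl _ e =
      contradiction (trans e (cong (f ∘ suc) (ℕₚ.+-identityʳ i))) (Adj⇒≢ G (f-Adj i))
    close i (suc zero) refl _ e =
      contradiction (sym (trans e (cong (f ∘ suc) (ℕₚ.+-comm i 1)))) (f-forward i)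
    close i (suc (suc k)) refl inj e = k , c , c-inj , c-next , c-close
      where
      c : Fin (suc (suc (suc k))) → Fin n
      c t = f (i + toℕ t)
      c-inj : Injective _≡_ _≡_ c
      c-inj {s} {t} eq = toℕ-injective (ℕₚ.+-cancelˡ-≡ i _ _
        (inj (below s) (below t) eq))
        where
        below : ∀ t → i + toℕ t ℕ.< suc (i + suc (suc k))
        below t = s≤s (ℕₚ.+-monoʳ-≤ i (ℕₚ.≤-pred (toℕ<n t)))
      c-next : ∀ t → Adj G (c (inject₁ t)) (c (suc t))
      c-next t = subst₂ (Adj G) (cong (λ h → f (i + h)) (sym (toℕ-inject₁ t)))
        (cong f (sym (ℕₚ.+-suc i (toℕ t)))) (f-Adj (i + toℕ t))
      c-close : Adj G (c (fromℕ (suc (suc k)))) (c zero)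
      c-close = subst₂ (Adj G) (cong (λ h → f (i + h)) (sym (toℕ-fromℕ (suc (suc k)))))
        (trans (sym e) (cong f (sym (ℕₚ.+-identityʳ i))))
        (f-Adj (i + suc (suc k)))

    search : ∀ j → InjectiveBelow j ⊎ Cycle G
    search zero = inj₁ λ ()
    search (suc j) with search j
    ... | inj₂ c = inj₂ c
    ... | inj₁ inj with any? {j} (λ i → f (toℕ i) ≟ f j)
    ... | yes (i , e) = let d , eq = ℕₚ.m≤n⇒∃[o]m+o≡n (toℕ<n i) in inj₂ (close (toℕ i) d eq inj e)
    ... | no fresh = inj₁ extend
      where
      fresh′ : ∀ {a} → a ℕ.< j → f a ≢ f j
      fresh′ a<j e = fresh (fromℕ< a<j , trans (cong f (toℕ-fromℕ< a<j)) e)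
      extend : InjectiveBelow (suc j)
      extend a<1+j b<1+j e with ℕₚ.m<1+n⇒m<n∨m≡n a<1+j | ℕₚ.m<1+n⇒m<n∨m≡n b<1+j
      ... | inj₁ a<j | inj₁ b<j = inj a<j b<j e
      ... | inj₁ a<j | inj₂ refl = contradiction e (fresh′ a<j)
      ... | inj₂ refl | inj₁ b<j = contradiction (sym e) (fresh′ b<j)
      ... | inj₂ refl | inj₂ refl = refl

  cycle : Cycle G
  cycle with search (suc n)
  ... | inj₂ c = c
  ... | inj₁ inj with i , j , i<j , e ← pigeonhole (ℕₚ.n<1+n n) (f ∘ toℕ) =
    contradiction (inj (toℕ<n i) (toℕ<n j) e) (ℕₚ.<⇒≢ i<j)

module _ {m} {T : Graph m} (acyclic : ¬ Cycle T) (luxury : LuxuryCondition T) where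
  chandelier-Pivot : Pivot (chandelier T) zero
  chandelier-Pivot = record { forest = forest ; independent = independent ; pendant = pendant }
    where
    C = chandelier T

    forest : ForestWithout C zero
    forest S ¬S0 core zero = ¬S0
    forest S ¬S0 core (suc x) Sx = acyclic (CoreCycle.cycle T lower Sx)
      where
      lower : Core T (S ∘ suc)
      lower x y Sx with core (suc x) (suc y) Sx
      ... | zero , S0 , _ = contradiction S0 ¬S0
      ... | suc z , Sz , xz , z≢y = z , Sz , xz , z≢y ∘ cong suc

    independent : ∀ k l → Adj C zero k → Adj C zero l → ¬ Adj C k l
    independent (suc k) (suc l) 0k 0l kl = case
      trans (sym (isLeaf⇒degree≡1 T l 0l)) (luxury k l (isLeaf⇒degree≡1 T k 0k) kl) of λ ()

    pendant : ∀ l y z → Adj C zero l → y ≢ zero → z ≢ zero → Adj C l y → Adj C l z → y ≡ z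
    pendant _ zero _ _ y≢0 = contradiction refl y≢0
    pendant _ _ zero _ _ z≢0 = contradiction refl z≢0
    pendant (suc l) (suc y) (suc z) 0l _ _ ly lz =
      let _ , _ , uniq = degree≡1⇒∃! T l (isLeaf⇒degree≡1 T l 0l) in cong suc (trans (uniq ly) (sym (uniq lz)))

-- Drawing a graph with a pivot

-- Finite families in a dense order without endpoints; used for < and for >.
module Room (_≺_ : ℚ → ℚ → Set) (≺-trans : ∀ {a b c} → a ≺ b → b ≺ c → a ≺ c)
            (≺? : ∀ a b → Dec (a ≺ b))
            (between : ∀ {a b c} → a ≺ b → a ≺ c → ∃[ t ] a ≺ t × t ≺ b × t ≺ c)
            (beyond : ∀ a b → ∃[ t ] a ≺ t × b ≺ t) where

  bound : ∀ {n} (f : Fin n → ℚ) → ∃[ t ] ∀ i → f i ≺ t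
  bound {zero}  f = 0ℚ , λ ()
  bound {suc n} f with bound (f ∘ suc)
  ... | s , f≺s with beyond (f zero) s
  ... | t , f₀≺t , s≺t = t , λ { zero → f₀≺t ; (suc i) → ≺-trans (f≺s i) s≺t }

  gap : ∀ {n} (f : Fin n → ℚ) {a b} → a ≺ b → ∃[ t ] a ≺ t × t ≺ b × (∀ i → a ≺ f i → t ≺ f i)
  gap {zero} f a≺b = let t , a≺t , t≺b , _ = between a≺b a≺b in t , a≺t , t≺b , λ ()
  gap {suc n} f {a} a≺b with gap (f ∘ suc) a≺b | ≺? a (f zero)
  ... | s , a≺s , s≺b , s≺f | no a⊀f₀ = s , a≺s , s≺b , λ { zero a≺f₀ → contradiction a≺f₀ a⊀f₀ ; (suc i) → s≺f i }
  ... | s , a≺s , s≺b , s≺f | yes a≺f₀ = let t , a≺t , t≺s , t≺f₀ = between a≺s a≺f₀ in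
    t , a≺t , ≺-trans t≺s s≺b , λ { zero _ → t≺f₀ ; (suc i) a≺fi → ≺-trans t≺s (s≺f i a≺fi) }

q<q+1 : ∀ q → q <ℚ q +ℚ 1ℚ
q<q+1 q = subst (_<ℚ q +ℚ 1ℚ) (ℚₚ.+-identityʳ q) (ℚₚ.+-monoʳ-< q (ℚₚ.positive⁻¹ 1ℚ))

q-1<q : ∀ q → q +ℚ - 1ℚ <ℚ q
q-1<q q = subst (q +ℚ - 1ℚ <ℚ_) (ℚₚ.+-identityʳ q) (ℚₚ.+-monoʳ-< q (ℚₚ.negative⁻¹ (- 1ℚ)))

<-between : ∀ {a b c} → a <ℚ b → a <ℚ c → ∃[ t ] a <ℚ t × t <ℚ b × t <ℚ c
<-between {b = b} {c} a<b a<c with ℚₚ.≤-total b c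
... | inj₁ b≤c = let t , a<t , t<b = ℚₚ.<-dense a<b in t , a<t , t<b , ℚₚ.<-≤-trans t<b b≤c
... | inj₂ c≤b = let t , a<t , t<c = ℚₚ.<-dense a<c in t , a<t , ℚₚ.<-≤-trans t<c c≤b , t<c

>-between : ∀ {a b c} → b <ℚ a → c <ℚ a → ∃[ t ] t <ℚ a × b <ℚ t × c <ℚ t
>-between {b = b} {c} b<a c<a with ℚₚ.≤-total b c
... | inj₁ b≤c = let t , c<t , t<a = ℚₚ.<-dense c<a in t , t<a , ℚₚ.≤-<-trans b≤c c<t , c<t
... | inj₂ c≤b = let t , b<t , t<a = ℚₚ.<-dense b<a in t , t<a , b<t , ℚₚ.≤-<-trans c≤b b<t

<-beyond : ∀ a b → ∃[ t ] a <ℚ t × b <ℚ t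
<-beyond a b with ℚₚ.≤-total a b
... | inj₁ a≤b = b +ℚ 1ℚ , ℚₚ.≤-<-trans a≤b (q<q+1 b) , q<q+1 b
... | inj₂ b≤a = a +ℚ 1ℚ , q<q+1 a , ℚₚ.≤-<-trans b≤a (q<q+1 a)

>-beyond : ∀ a b → ∃[ t ] t <ℚ a × t <ℚ b
>-beyond a b with ℚₚ.≤-total a b
... | inj₁ a≤b = a +ℚ - 1ℚ , q-1<q a , ℚₚ.<-≤-trans (q-1<q a) a≤b
... | inj₂ b≤a = b +ℚ - 1ℚ , ℚₚ.<-≤-trans (q-1<q b) b≤a , q-1<q b

module Above = Room _<ℚ_ ℚₚ.<-trans ℚₚ._<?_ <-between <-beyond
module Below = Room (flip _<ℚ_) (flip ℚₚ.<-trans) (flip ℚₚ._<?_) >-between >-beyond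

module Draw {n} (G : Graph n) {p} (P : Pivot G p) where
  open Pivot P

  -- Placements of the frames of G − p. Only a vertex that is not a neighbour of p has a frame to its
  -- right, so the frames of the neighbours of p can be extended to the right.
  data Placed (A B : Frame) (u v : Fin n) : Set where
    below : yt A <ℚ yb B → ¬ Adj G u v → Placed A B u v
    child : Enters A B → Adj G u v → ¬ Adj G p u → Placed A B u v
    deep  : yb A <ℚ yb B → yt B <ℚ yt A → xr A <ℚ xl B → ¬ Adj G u v → ¬ Adj G p u → Placed A B u v

  Layout : Subset n → (Fin n → Frame) → Set
  Layout S F = ∀ {u v} → u ∈ S → v ∈ S → u ≢ v → Placed (F u) (F v) u v ⊎ Placed (F v) (F u) v u

  -- Vertices are removed in the reverse of the order of drawing. Neighbours of p are removed first,
  -- hence drawn last, and never receive a child.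
  Removable : Subset n → Fin n → Set
  Removable S v = v ∈ S × (∀ {y z} → y ∈ S → z ∈ S → Adj G v y → Adj G v z → y ≡ z)
                × (Adj G p v ⊎ ∀ {u} → u ∈ S → ¬ Adj G p u)

  -- A neighbour of p has at most one neighbour in S by `pendant`. If S contains none of them, some
  -- vertex of S still has at most one neighbour in S, as otherwise S would be a core in G - p.
  removable : ∀ {S} → p ∉ S → Nonempty S → ∃ (Removable S)
  removable {S} p∉S (x , x∈S) with any? (λ l → l ∈? S ×-dec Adj? G p l)
  ... | yes (l , l∈S , pl) = l , l∈S , (λ y∈S z∈S → pendant l _ _ pl (∈⇒≢p y∈S) (∈⇒≢p z∈S)) , inj₁ pl
    where
    ∈⇒≢p : ∀ {y} → y ∈ S → y ≢ p
    ∈⇒≢p y∈S refl = p∉S y∈S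
  ... | no ∄l with any? (λ v → v ∈? S ×-dec all? (λ y → all? (λ z →
                     y ∈? S →-dec (z ∈? S →-dec (Adj? G v y →-dec (Adj? G v z →-dec y ≟ z))))))
  ... | yes (v , v∈S , uniq) = v , v∈S , (λ y∈S z∈S → uniq _ _ y∈S z∈S) , inj₂ λ u∈S pu → ∄l (_ , u∈S , pu)
  ... | no ∄v = contradiction x∈S (forest (_∈ S) p∉S core x)
    where
    core : Core G (_∈ S)
    core x y x∈S with any? (λ z → z ∈? S ×-dec (Adj? G x z ×-dec ¬? (z ≟ y)))
    ... | yes found = found
    ... | no ∄z = contradiction (x , x∈S , λ z z′ z∈S z′∈S xz xz′ → trans (≡y z∈S xz) (sym (≡y z′∈S xz′))) ∄v
      where
      ≡y : ∀ {z} → z ∈ S → Adj G x z → z ≡ y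
      ≡y z∈S xz = decidable-stable (_ ≟ y) λ z≢y → ∄z (_ , z∈S , xz , z≢y)

  swap-Adj : ∀ {u v} → ¬ Adj G u v → ¬ Adj G v u
  swap-Adj ¬uv = ¬uv ∘ Adj-sym G

  record Addition (S : Subset n) (F : Fin n → Frame) (v : Fin n) : Set where
    field
      frame  : Frame
      placed : ∀ {w} → w ∈ S → Placed (F w) frame w v ⊎ Placed frame (F w) v w

  add-root : ∀ {S} F {v} → (∀ {w} → w ∈ S → ¬ Adj G v w) → Addition S F v
  add-root F isolated = let b , above = Above.bound (yt ∘ F) in record
    { frame = record { xl = 0ℚ ; xr = 0ℚ +ℚ 1ℚ ; yb = b ; yt = b +ℚ 1ℚ ; xl<xr = q<q+1 0ℚ ; yb<yt = q<q+1 b }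
    ; placed = λ {w} w∈S → inj₁ (below (above w) (swap-Adj (isolated w∈S))) }

  -- The frame of a child of u crosses the right side of u at the bottom, below every frame that
  -- starts above the bottom of u and to the right of every frame that ends before u does.
  add-child : ∀ {S F v u} → Layout S F → u ∈ S → Adj G u v → ¬ Adj G p u →
              (∀ {w} → w ∈ S → w ≢ u → ¬ Adj G v w) → Addition S F v
  add-child {S} {F} {v} {u} lay u∈S uv ¬pu others = addition
    where
    addition : Addition S F v
    addition with Above.gap (yb ∘ F) (yb<yt (F u)) | Below.gap (xr ∘ F) (xl<xr (F u))
    ... | t , b<t , t<t , t<b | l , l<r , l>l , l>r with ℚₚ.<-dense b<t
    ... | b , b<b , b<t′ = record { frame = new ; placed = placed }
      where
      new : Frame
      new = record { xl = l ; xr = xr (F u) +ℚ 1ℚ ; yb = b ; yt = t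
                   ; xl<xr = ℚₚ.<-trans l<r (q<q+1 _) ; yb<yt = b<t′ }

      placed : ∀ {w} → w ∈ S → Placed (F w) new w v ⊎ Placed new (F w) v w
      placed {w} w∈S with w ≟ u
      ... | yes refl = inj₁ (child (enters l>l l<r (q<q+1 _) b<b t<t) uv ¬pu)
      ... | no w≢u with lay w∈S u∈S w≢u | others w∈S w≢u
      ... | inj₁ (below t<b′ _) | ¬vw = inj₁ (below (ℚₚ.<-trans t<b′ b<b) (swap-Adj ¬vw))
      ... | inj₁ (child (enters _ _ r<r b<b′ t<t′) _ ¬pw) | ¬vw =
        inj₁ (deep (ℚₚ.<-trans b<b′ b<b) (ℚₚ.<-trans t<t t<t′) (l>r w r<r) (swap-Adj ¬vw) ¬pw)
      ... | inj₁ (deep b<b′ t<t′ r<l _ ¬pw) | ¬vw =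
        inj₁ (deep (ℚₚ.<-trans b<b′ b<b) (ℚₚ.<-trans t<t t<t′) (ℚₚ.<-trans r<l l>l) (swap-Adj ¬vw) ¬pw)
      ... | inj₂ (below t<b′ _) | ¬vw = inj₂ (below (ℚₚ.<-trans t<t t<b′) ¬vw)
      ... | inj₂ (child (enters _ _ _ b<b′ _) _ _) | ¬vw = inj₂ (below (t<b w b<b′) ¬vw)
      ... | inj₂ (deep b<b′ _ _ _ _) | ¬vw = inj₂ (below (t<b w b<b′) ¬vw)

  extend : ∀ {S F v} → Layout (S - v) F → Addition (S - v) F v → ∃ (Layout S)
  extend {S} {F} {v} lay A = F′ , lay′
    where
    open Addition A
    F′ : Fin n → Frame
    F′ w with w ≟ v
    ... | yes _ = frame
    ... | no _  = F w

    rest : ∀ {w} → w ∈ S → w ≢ v → w ∈ S - v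
    rest = x∈p∧x≢y⇒x∈p-y

    lay′ : Layout S F′
    lay′ {u} {w} u∈S w∈S u≢w with u ≟ v | w ≟ v
    ... | yes refl | yes refl = contradiction refl u≢w
    ... | yes refl | no w≢v = [ inj₂ , inj₁ ]′ (placed (rest w∈S w≢v))
    ... | no u≢v | yes refl = placed (rest u∈S u≢v)
    ... | no u≢v | no w≢v = lay (rest u∈S u≢v) (rest w∈S w≢v) u≢w

  layout : ∀ {S} → p ∉ S → ∃ (Layout S)
  layout = go (⊂-wellFounded _)
    where
    unit : Frame
    unit = record { xl = 0ℚ ; xr = 0ℚ +ℚ 1ℚ ; yb = 0ℚ ; yt = 0ℚ +ℚ 1ℚ ; xl<xr = q<q+1 0ℚ ; yb<yt = q<q+1 0ℚ }

    go : ∀ {S} → Acc Subset._⊂_ S → p ∉ S → ∃ (Layout S)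
    go {S} (acc rs) p∉S with nonempty? S
    ... | no empty = (λ _ → unit) , λ u∈S → contradiction (_ , u∈S) empty
    ... | yes nonempty with removable p∉S nonempty
    ... | v , v∈S , uniq , leaf with go (rs (x∈p⇒p-x⊂p v∈S)) (p∉S ∘ p─q⊆p S ⁅ v ⁆)
    ... | F , lay with any? (λ u → u ∈? (S - v) ×-dec Adj? G v u)
    ... | no ∄u = extend lay (add-root F λ w∈ vw → ∄u (_ , w∈ , vw))
    ... | yes (u , u∈ , vu) = extend lay (add-child lay u∈ (Adj-sym G vu) ¬pu
            λ w∈ w≢u vw → w≢u (uniq (p─q⊆p S ⁅ v ⁆ w∈) (p─q⊆p S ⁅ v ⁆ u∈) vw vu))
      where
      ¬pu : ¬ Adj G p u
      ¬pu = [ (λ pv pu → independent v u pv pu vu) , (λ none → none (p─q⊆p S ⁅ v ⁆ u∈)) ]′ leaf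

  -- `nest` records that only the frame of p surrounds another one, on which condition (4) will
  -- rest.
  data Drawn (A B : Frame) (u v : Fin n) : Set where
    below : yt A <ℚ yb B → ¬ Adj G u v → Drawn A B u v
    left  : xr A <ℚ xl B → ¬ Adj G u v → Drawn A B u v
    cross : Enters A B → Adj G u v → Drawn A B u v
    nest  : Inside B A → u ≡ p → ¬ Adj G u v → Drawn A B u v

  Drawing : (Fin n → Frame) → Set
  Drawing K = ∀ u v → u ≢ v → Drawn (K u) (K v) u v ⊎ Drawn (K v) (K u) v u

  drawing : ∃ Drawing
  drawing with layout {∁ ⁅ p ⁆} (λ p∈ → x∈∁p⇒x∉p p∈ (x∈⁅x⁆ p))
  ... | F , lay with Above.bound (xr ∘ F) | Below.bound (xl ∘ F) | Above.bound (yt ∘ F) | Below.bound (yb ∘ F)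
  ... | X , <X | x , x< | Y , <Y | y , y< = K , draw
    where
    pivot : Frame
    pivot = record { xl = x ; xr = X ; yb = y ; yt = Y
                   ; xl<xr = ℚₚ.<-trans (x< p) (ℚₚ.<-trans (xl<xr (F p)) (<X p))
                   ; yb<yt = ℚₚ.<-trans (y< p) (ℚₚ.<-trans (yb<yt (F p)) (<Y p)) }

    -- Any right end beyond X crosses the right side of p. The common value is harmless, because two
    -- neighbours of p are always stacked by `below`.
    long : Fin n → Frame
    long w = record (F w) { xr = X +ℚ 1ℚ ; xl<xr = ℚₚ.<-trans (xl<xr (F w)) (ℚₚ.<-trans (<X w) (q<q+1 X)) }

    K : Fin n → Frame
    K w with w ≟ p | Adj? G p w
    ... | yes _ | _     = pivot
    ... | no _  | yes _ = long w
    ... | no _  | no _  = F w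

    with-pivot : ∀ {w} → w ≢ p → Drawn pivot (K w) p w
    with-pivot {w} w≢p with w ≟ p | Adj? G p w
    ... | yes w≡p | _ = contradiction w≡p w≢p
    ... | no _ | yes pw = cross (enters (x< w) (ℚₚ.<-trans (xl<xr (F w)) (<X w)) (q<q+1 X) (y< w) (<Y w)) pw
    ... | no _ | no ¬pw = nest (inside (x< w) (<X w) (y< w) (<Y w)) refl ¬pw

    -- Extension to the right does not affect `below`; in the other two placements u is not a
    -- neighbour of p, so at most the frame further right is extended.
    without-pivot : ∀ {u v} → u ≢ p → v ≢ p → Placed (F u) (F v) u v → Drawn (K u) (K v) u v
    without-pivot {u} {v} u≢p v≢p pl with u ≟ p | v ≟ p | Adj? G p u | Adj? G p v | pl
    ... | yes u≡p | _ | _ | _ | _ = contradiction u≡p u≢p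
    ... | no _ | yes v≡p | _ | _ | _ = contradiction v≡p v≢p
    ... | no _ | no _ | yes _ | yes _ | below t<b ¬uv = below t<b ¬uv
    ... | no _ | no _ | yes _ | no _  | below t<b ¬uv = below t<b ¬uv
    ... | no _ | no _ | no _  | yes _ | below t<b ¬uv = below t<b ¬uv
    ... | no _ | no _ | no _  | no _  | below t<b ¬uv = below t<b ¬uv
    ... | no _ | no _ | yes pu | _ | child _ _ ¬pu = contradiction pu ¬pu
    ... | no _ | no _ | no _ | yes _ | child (enters a b c d e) uv _ =
      cross (enters a b (ℚₚ.<-trans (<X u) (q<q+1 X)) d e) uv
    ... | no _ | no _ | no _ | no _ | child e uv _ = cross e uv
    ... | no _ | no _ | yes pu | _ | deep _ _ _ _ ¬pu = contradiction pu ¬pu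
    ... | no _ | no _ | no _ | yes _ | deep _ _ r<l ¬uv _ = left r<l ¬uv
    ... | no _ | no _ | no _ | no _ | deep _ _ r<l ¬uv _ = left r<l ¬uv

    K-pivot : K p ≡ pivot
    K-pivot with p ≟ p
    ... | yes _ = refl
    ... | no p≢p = contradiction refl p≢p

    ∈rest : ∀ {w} → w ≢ p → w ∈ ∁ ⁅ p ⁆
    ∈rest = x∉p⇒x∈∁p ∘ x≢y⇒x∉⁅y⁆

    draw : Drawing K
    draw u v u≢v = by (u ≟ p) (v ≟ p)
      where
      pivot-first : ∀ {w} → w ≢ p → Drawn (K p) (K w) p w
      pivot-first {w} w≢p = subst (λ A → Drawn A (K w) p w) (sym K-pivot) (with-pivot w≢p)
      by : Dec (u ≡ p) → Dec (v ≡ p) → Drawn (K u) (K v) u v ⊎ Drawn (K v) (K u) v u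
      by (yes refl) _ = inj₁ (pivot-first (≢-sym u≢v))
      by (no u≢p) (yes refl) = inj₂ (pivot-first u≢p)
      by (no u≢p) (no v≢p) with lay (∈rest u≢p) (∈rest v≢p) u≢v
      ... | inj₁ pl = inj₁ (without-pivot u≢p v≢p pl)
      ... | inj₂ pl = inj₂ (without-pivot v≢p u≢p pl)

-- Verification of the four conditions for a drawing

module _ {n} (G : Graph n) {p} (P : Pivot G p) where
  open Draw G P

  drawing⇒restrictedFrame : ∃ Drawing → IsRestrictedFrameGraph G
  drawing⇒restrictedFrame (K , drawn) = K , represents , cond1 , cond2 , cond3 , cond4
    where
    data Kind (u v : Fin n) : Set where
      forward  : Enters (K u) (K v) → Adj G u v → Kind u v
      backward : Enters (K v) (K u) → Adj G u v → Kind u v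
      apart    : ¬ Intersect (K u) (K v) → ¬ Adj G u v → Kind u v

    kind : ∀ u v → u ≢ v → Kind u v
    kind u v u≢v with drawn u v u≢v
    ... | inj₁ (below t<b ¬uv) = apart (below⇒¬Intersect {K u} {K v} t<b) ¬uv
    ... | inj₁ (left r<l ¬uv) = apart (left⇒¬Intersect {K u} {K v} r<l) ¬uv
    ... | inj₁ (cross e uv) = forward e uv
    ... | inj₁ (nest i _ ¬uv) = apart (Inside⇒¬Intersect i) ¬uv
    ... | inj₂ (below t<b ¬vu) = apart (below⇒¬Intersect {K v} {K u} t<b ∘ Intersect-sym {K u} {K v}) (swap-Adj ¬vu)
    ... | inj₂ (left r<l ¬vu) = apart (left⇒¬Intersect {K v} {K u} r<l ∘ Intersect-sym {K u} {K v}) (swap-Adj ¬vu)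
    ... | inj₂ (cross e vu) = backward e (Adj-sym G vu)
    ... | inj₂ (nest i _ ¬vu) = apart (Inside⇒¬Intersect i ∘ Intersect-sym {K u} {K v}) (swap-Adj ¬vu)

    represents : Represents K G
    represents u v u≢v with kind u v u≢v
    ... | forward e uv = (λ _ → Enters⇒Intersect e) , λ _ → uv
    ... | backward e uv = (λ _ → Intersect-sym {K v} {K u} (Enters⇒Intersect e)) , λ _ → uv
    ... | apart ¬i ¬uv = (λ uv → contradiction uv ¬uv) , λ i → contradiction i ¬i

    cond1 : Cond1 K
    cond1 u v u≢v q c on with kind u v u≢v
    ... | forward e _ = Enters-corner e q c on
    ... | backward e _ = Enters-corner′ e q c on
    ... | apart ¬i _ = ¬i (q , corner⇒OnFrame (K u) c , on)

    cond2 : Cond2 K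
    cond2 u v u≢v m@(q , l , on) with kind u v u≢v
    ... | forward e _ = Enters-left e m
    ... | backward e _ = Enters-left′ e m
    ... | apart ¬i _ = ¬i (q , inj₁ l , on)

    cond3 : Cond3 K
    cond3 u v u≢v m@(q , r , on) with kind u v u≢v
    ... | forward e _ = Enters-top e , Enters-bottom e
    ... | backward e _ = contradiction m (Enters-right′ e)
    ... | apart ¬i _ = contradiction (q , inj₂ (inj₁ r) , on) ¬i

    Within⇒pivot : ∀ {w u} → w ≢ u → Within (K w) (K u) → u ≡ p
    Within⇒pivot {w} {u} w≢u within with Within⇒≤ {K w} {K u} within | drawn w u w≢u
    ... | l , r , b , t | inj₁ (below t<b _) = contradiction (ℚₚ.≤-trans b (ℚₚ.<⇒≤ (yb<yt (K w)))) (<⇒≱ℚ t<b)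
    ... | l , r , b , t | inj₁ (left r<l _) = contradiction (ℚₚ.≤-trans l (ℚₚ.<⇒≤ (xl<xr (K w)))) (<⇒≱ℚ r<l)
    ... | l , r , b , t | inj₁ (cross e _) = contradiction l (<⇒≱ℚ (Enters.xl<xl e))
    ... | l , r , b , t | inj₁ (nest i _ _) = contradiction l (<⇒≱ℚ (Inside.xl<xl i))
    ... | l , r , b , t | inj₂ (below t<b _) = contradiction (ℚₚ.≤-trans (ℚₚ.<⇒≤ (yb<yt (K w))) t) (<⇒≱ℚ t<b)
    ... | l , r , b , t | inj₂ (left r<l _) = contradiction (ℚₚ.≤-trans (ℚₚ.<⇒≤ (xl<xr (K w))) r) (<⇒≱ℚ r<l)
    ... | l , r , b , t | inj₂ (cross e _) = contradiction r (<⇒≱ℚ (Enters.xr<xr e))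
    ... | l , r , b , t | inj₂ (nest _ u≡p _) = u≡p

    -- Neither of two crossing frames contains the other, and a third frame is contained in no frame
    -- but that of p.
    not-within-both : ∀ {u v} → u ≢ v → Enters (K u) (K v) → ∀ w → Within (K w) (K u) → ¬ Within (K w) (K v)
    not-within-both {u} {v} u≢v e w wu wv with w ≟ u | w ≟ v
    ... | yes refl | _ = <⇒≱ℚ (Enters.xl<xl e) (proj₁ (Within⇒≤ {K u} {K v} wv))
    ... | no _ | yes refl = <⇒≱ℚ (Enters.xr<xr e) (proj₁ (proj₂ (Within⇒≤ {K v} {K u} wu)))
    ... | no w≢u | no w≢v = u≢v (trans (Within⇒pivot w≢u wu) (sym (Within⇒pivot w≢v wv)))

    cond4 : Cond4 K
    cond4 u v u≢v i w within with kind u v u≢v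
    ... | forward e _ = not-within-both u≢v e w (λ q → proj₁ ∘ within q) (λ q → proj₂ ∘ within q)
    ... | backward e _ = not-within-both (≢-sym u≢v) e w (λ q → proj₂ ∘ within q) (λ q → proj₁ ∘ within q)
    ... | apart ¬i _ = ¬i i

  Pivot⇒restrictedFrame : IsRestrictedFrameGraph G
  Pivot⇒restrictedFrame = drawing⇒restrictedFrame drawing

-- Without a hub any vertex may be removed; this one shows that there is a vertex at all.
subdivision-vertex : ∀ {n m} {H : Graph n} {G : Graph m} → IsSubdivision H G → Fin n → Fin m
subdivision-vertex (base i) v = _≅_.to i v
subdivision-vertex (step s a b ab i) v = _≅_.to i zero

class⇒Pivot : ∀ {n} {H : Graph n} → IsSmallPath H ⊎ IsLuxuryChandelier H → ∃ (Pivot H)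
class⇒Pivot (inj₁ (suc k , _ , _ , i)) = _ , Pivot-≅ i (path-Pivot k)
class⇒Pivot (inj₂ (_ , _ , (_ , acyclic) , luxury , i)) = _ , Pivot-≅ i (chandelier-Pivot acyclic luxury)

theorem1 : ∀ {n m} (H : Graph n) (Hs : Graph m) →
    Connected H → TriangleFree H → ¬ HasFullStarCutset H →
    IsSubdivision H Hs →
    (IsRestrictedFrameGraph Hs ⇔ (IsSmallPath H ⊎ IsLuxuryChandelier H))
theorem1 {zero} _ _ (() , _)
theorem1 {suc n} H Hs conn tri noFSC sub = mk⇔ to from
  where
  from : IsSmallPath H ⊎ IsLuxuryChandelier H → IsRestrictedFrameGraph Hs
  from c = Pivot⇒restrictedFrame Hs (proj₂ (subdivision-Pivot sub (class⇒Pivot c)))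

  to : IsRestrictedFrameGraph Hs → IsSmallPath H ⊎ IsLuxuryChandelier H
  to (Fs , rep , c1 , c2 , c3 , _) with smallPath-or-minDegree H conn tri noFSC
  ... | inj₁ path = inj₁ path
  ... | inj₂ core = inj₂ (Decompose.robust⇒luxuryChandelier robust (proj₂ (subdivision-forest sub forest)))
    where
    robust : Robust H
    robust = record { triangleFree = tri ; minDegree = core ; connect = noFullStarCutset⇒connect H noFSC }
    forest : ∃ (ForestWithout Hs)
    forest = restrictedFrame⇒forest (subdivision-Robust sub robust) Fs rep c1 c2 c3 (subdivision-vertex sub zero)
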